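{- Let $p$ be a prime, $n\ge 1$ an integer and $q=p^n$. Let $\zeta$ be a primitive element of $\mathbb{F}_q$ and let $\lambda\in\mathbb{F}_q$ be such that $\mathbb{F}_q=\mathbb{F}_p(\lambda)$, so that $(1,\lambda,\ldots,\lambda^{n-1})$ is a basis of $\mathbb{F}_q$ over $\mathbb{F}_p$. Define $f:\mathbb{F}_q\to\mathbb{F}_q$ by $$f(\zeta^x)=x_0+x_1\lambda+\cdots+x_{n-1}\lambda^{n-1},\qquad x=0,1,\ldots,q-2,$$ where $x=x_0+x_1p+\cdots+x_{n-1}p^{n-1}$ with integers $0\le x_0,x_1,\ldots,x_{n-1}<p$, and $$f(0)=-1-\lambda-\cdots-\lambda^{n-1}.$$ Then the permutation $f$ (identified with the unique polynomial of degree at most $q-1$ representing it) satisfies $$\deg(f)\ge q-\frac{q}{p}-1,\qquad \mathrm{w}(f)\ge q-\frac{q}{p},\qquad \mathrm{AddInd}(f)\ge\frac{p^n}{n+2},$$ and, if $p>2$, $$\mathrm{Crk}(f)\ge p^n-3(2p)^{n/2}.$$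
   Context: Degree and weight: every map $f:\mathbb{F}_q\to\mathbb{F}_q$ coincides on $\mathbb{F}_q$ with a unique polynomial $P_f\in\mathbb{F}_q[x]$ of degree at most $q-1$; $\deg(f)$ is the degree of $P_f$ and the weight $\mathrm{w}(f)$ is the number of nonzero coefficients of $P_f$. Additive index: view $\mathbb{F}_q$ as an $n$-dimensional vector space over $\mathbb{F}_p$. A map $f:\mathbb{F}_q\to\mathbb{F}_q$ is of codimension at most $k$ ($0\le k\le n$) if there are an $\mathbb{F}_p$-linear map $M:\mathbb{F}_q\to\mathbb{F}_q$ (equivalently, a map induced by a linearised polynomial $\sum_j a_jX^{p^j}$, $a_j\in\mathbb{F}_q$) and an $\mathbb{F}_p$-subspace $U$ of $\mathbb{F}_q$ of dimension $n-k$ such that $f-M$ is constant on each coset of $U$. The codimension $\mathrm{codim}\, f$ is the smallest such $k$, and $\mathrm{AddInd}(f)=p^{\mathrm{codim}\, f}$. Carlitz rank: by a theorem of Carlitz, for $q\ge 3$ the group of permutations of $\mathbb{F}_q$ under composition is generated by the inversion map ($0\mapsto 0$, $x\mapsto x^{ -1}$ for $x\ne 0$; i.e. $x\mapsto x^{q-2}$) and all affine maps $x\mapsto \alpha x+\beta$ with $\alpha,\beta\in\mathbb{F}_q$, $\alpha\neq 0$. The Carlitz rank $\mathrm{Crk}(f)$ of a permutation $f$ of $\mathbb{F}_q$ is the minimum number of inversions needed to write $f$ as a composition of inversions and such affine maps. -}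

module Defs where

open import Algebra.Bundles using (CommutativeRing)
open import Algebra.Structures using (IsCommutativeRing)
open import Data.Fin using (Fin; toℕ)
open import Data.List using (List; []; _∷_; length; map; filter; allFin)
open import Data.List.Extrema.Nat using (max)
open import Data.Nat as ℕ using (ℕ; suc; _∸_; _<_; _≤_)
open import Data.Nat.Properties using (+-0-monoid)
open import Data.Product using (Σ-syntax; ∃-syntax; _×_)
open import Data.Vec.Functional using (Vector)
open import Function using (_∘_; id; _↔_)
open import Function.Properties.Inverse using (↔⇒↣)
open import Level using (Level) renaming (suc to lsuc)
open import Relation.Binary.Definitions using (DecidableEquality)
open import Relation.Binary.PropositionalEquality using (_≡_; _≢_; _≗_)
open import Relation.Nullary.Decidable using (¬?)
open import Relation.Unary using (Pred; _∈_)
import Algebra.Bundles as Bundles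
import Algebra.Definitions.RawMonoid as RawMonoidDefinitions
import Algebra.Definitions.RawSemiring as RawSemiringDefinitions
import Data.Fin.Properties as Fin

private
  variable
    a : Level

record FiniteField (c : Level) (q : ℕ) : Set (lsuc c) where
  infix  8 -_
  infixl 7 _*_
  infixl 6 _+_ _-_
  infix  9 _⁻¹
  field
    Carrier           : Set c
    _+_ _*_           : Carrier → Carrier → Carrier
    -_ _⁻¹            : Carrier → Carrier
    0# 1#             : Carrier
    isCommutativeRing : IsCommutativeRing _≡_ _+_ _*_ -_ 0# 1#
    1≢0               : 1# ≢ 0#
    *-inverseʳ        : ∀ x → x ≢ 0# → x * x ⁻¹ ≡ 1#
    -- Makes _⁻¹ itself the inversion map 0 ↦ 0, x ↦ x⁻¹ (x ≠ 0).
    0⁻¹≡0             : 0# ⁻¹ ≡ 0#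
    enumeration       : Carrier ↔ Fin q

  commutativeRing : CommutativeRing c c
  commutativeRing = record { isCommutativeRing = isCommutativeRing }

  open RawSemiringDefinitions (Bundles.Semiring.rawSemiring
    (CommutativeRing.semiring commutativeRing)) public
    using (sum; _^_) renaming (_×_ to _×ᶠ_)

  _-_ : Carrier → Carrier → Carrier
  x - y = x + - y

  _≟_ : DecidableEquality Carrier
  _≟_ = Fin.inj⇒≟ (↔⇒↣ enumeration)

Σℕ : ∀ {n} → Vector ℕ n → ℕ
Σℕ = RawMonoidDefinitions.sum (Bundles.Monoid.rawMonoid +-0-monoid)

IsLeast : (ℕ → Set a) → ℕ → Set a
IsLeast P k = P k × (∀ j → P j → k ≤ j)

module _ {c : Level} {q : ℕ} (F : FiniteField c q) where
  open FiniteField F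

  IsPrimitive : Carrier → Set c
  IsPrimitive ζ = ζ ≢ 0# × (∀ y → y ≢ 0# → ∃[ i ] ζ ^ i ≡ y)

  -- Coefficients of degrees 0, …, q - 1.
  Polynomial : Set c
  Polynomial = Vector Carrier q

  evaluate : Polynomial → Carrier → Carrier
  evaluate P x = sum (λ i → P i * x ^ toℕ i)

  Represents : Polynomial → (Carrier → Carrier) → Set c
  Represents P f = evaluate P ≗ f

  support : Polynomial → List (Fin q)
  support P = filter (λ i → ¬? (P i ≟ 0#)) (allFin q)

  -- The zero polynomial is given degree 0.
  degree : Polynomial → ℕ
  degree P = max 0 (map toℕ (support P))

  weight : Polynomial → ℕ
  weight P = length (support P)

  data Generator : Set c where
    affine    : (α β : Carrier) → α ≢ 0# → Generator
    inversion : Generator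

  ⟦_⟧ : Generator → Carrier → Carrier
  ⟦ affine α β _ ⟧ x = α * x + β
  ⟦ inversion    ⟧ x = x ⁻¹

  compose : List Generator → Carrier → Carrier
  compose []       = id
  compose (g ∷ gs) = ⟦ g ⟧ ∘ compose gs

  inversions : List Generator → ℕ
  inversions []                  = 0
  inversions (affine _ _ _ ∷ gs) = inversions gs
  inversions (inversion    ∷ gs) = suc (inversions gs)

  IsCarlitzRank : (Carrier → Carrier) → ℕ → Set c
  IsCarlitzRank f =
    IsLeast (λ r → ∃[ gs ] inversions gs ≡ r × compose gs ≗ f)

-- Here 𝔽ₚ is represented by the residues Fin p, acting on the field by
-- natural multiples; this is the 𝔽ₚ-vector space structure when q is a
-- power of the prime p.
module _ (p : ℕ) {c : Level} {q : ℕ} (F : FiniteField c q) where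
  open FiniteField F

  infixr 8 _·_

  _·_ : Fin p → Carrier → Carrier
  k · x = toℕ k ×ᶠ x

  -- The subfield 𝔽ₚ(θ).
  data Adjoin (θ : Carrier) : Pred Carrier c where
    scalar    : ∀ k → k · 1# ∈ Adjoin θ
    generator : θ ∈ Adjoin θ
    add       : ∀ {x y} → x ∈ Adjoin θ → y ∈ Adjoin θ → x + y ∈ Adjoin θ
    negate    : ∀ {x} → x ∈ Adjoin θ → - x ∈ Adjoin θ
    multiply  : ∀ {x y} → x ∈ Adjoin θ → y ∈ Adjoin θ → x * y ∈ Adjoin θ
    invert    : ∀ {x} → x ∈ Adjoin θ → x ⁻¹ ∈ Adjoin θ

  combination : ∀ {d} → Vector (Fin p) d → Vector Carrier d → Carrier
  combination k b = sum (λ i → k i · b i)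

  LinearlyIndependent : ∀ {d} → Vector Carrier d → Set c
  LinearlyIndependent b =
    ∀ k → combination k b ≡ 0# → ∀ i → toℕ (k i) ≡ 0

  record IsLinear (M : Carrier → Carrier) : Set c where
    field
      additive    : ∀ x y → M (x + y) ≡ M x + M y
      homogeneous : ∀ k x → M (k · x) ≡ k · M x

  record IsSubspace (U : Pred Carrier c) : Set c where
    field
      0∈       : 0# ∈ U
      +-closed : ∀ {x y} → x ∈ U → y ∈ U → x + y ∈ U
      ·-closed : ∀ k {x} → x ∈ U → k · x ∈ U

  HasDimension : Pred Carrier c → ℕ → Set c
  HasDimension U d = Σ[ b ∈ Vector Carrier d ]
    (∀ i → b i ∈ U) ×
    LinearlyIndependent b ×
    (∀ {x} → x ∈ U → ∃[ k ] combination k b ≡ x)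

  ConstantOnCosets : Pred Carrier c → (Carrier → Carrier) → Set c
  ConstantOnCosets U g = ∀ x y → x - y ∈ U → g x ≡ g y

  -- The field is regarded as n-dimensional over 𝔽ₚ.
  CodimensionAtMost : ℕ → (Carrier → Carrier) → ℕ → Set (lsuc c)
  CodimensionAtMost n f k =
    k ≤ n ×
    Σ[ M ∈ (Carrier → Carrier) ] Σ[ U ∈ Pred Carrier c ]
      IsLinear M ×
      IsSubspace U ×
      HasDimension U (n ∸ k) ×
      ConstantOnCosets U (λ x → f x - M x)

  IsCodimension : ℕ → (Carrier → Carrier) → ℕ → Set (lsuc c)
  IsCodimension n f = IsLeast (CodimensionAtMost n f)

  IsAdditiveIndex : ℕ → (Carrier → Carrier) → ℕ → Set (lsuc c)
  IsAdditiveIndex n f m = ∃[ k ] IsCodimension n f k × m ≡ p ℕ.^ k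

  -- Base-p digits are listed least significant first.
  record IsDigitMap (n : ℕ) (ζ θ : Carrier) (f : Carrier → Carrier) : Set c where
    field
      at-power : ∀ x → x < q ∸ 1 →
        (d : Vector (Fin p) n) → x ≡ Σℕ (λ i → toℕ (d i) ℕ.* p ℕ.^ toℕ i) →
        f (ζ ^ x) ≡ combination d (λ i → θ ^ toℕ i)
      at-zero  : f 0# ≡ - sum {n} (λ i → θ ^ toℕ i)

-- Adding 1 or p^(n-1) to an exponent acts on digit vectors almost linearly, and each
-- bound plays this against a rigid algebraic structure.
--
-- Weight and degree: f (ζ^(x + p^(n-1))) = f (ζ^x) + θ^(n-1) for the first q - q/p - 1
-- values of x.  For the coefficients a_i of f this reads Σ a_i (ζ^(i p^(n-1)) - 1) ζ^(i x)
-- = θ^(n-1), and a sum with fewer nodes ζ^i than identities would force θ^(n-1) = 0,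
-- as in the BCH bound.
--
-- Additive index: carrying leaves only n + 2 values for f (ζ x) - f x.  If f - M is
-- constant on cosets of U, then M takes |U| values f (x + u) - f x, and x = u / (ζ - 1)
-- turns each of them into such a difference.
--
-- Carlitz rank: off at most r points f agrees with a fractional linear map.  For pairs
-- (x , y) of agreement points with x ≠ y, the digitwise difference determines x / y and
-- f x - f y, which leaves a nonzero quadratic equation for y.  So each of the at most
-- (2p)^n differences occurs at most twice.

module Submission where

-- So f sends every point to the combination of its digits, and injectivity of f comes from the
-- linear independence of the powers of θ. The repair is additive only, because ζ^(q-1) is 1 and not
-- 0; hence 0 is one of the two exceptional points for the additive index and is discarded in the
-- Carlitz count. For the weight, the constant θ^(n-1) is itself an exponential sequence, with node
-- 1. That node must stay on the right while it disappears on the left, which the factor ζ^(i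
-- p^(n-1)) - 1 ensures. Since f 0 ≠ 0, the term of degree 0 lies in the support and has node 1;
-- this makes up for the one identity by which q - q/p - 1 falls short of q - q/p. The degree bound
-- follows, a polynomial of degree d having at most d + 1 nonzero coefficients.

open import Defs
open import Algebra.Bundles using (CommutativeRing; RawRing)
open import Algebra.Solver.Ring.AlmostCommutativeRing using (fromCommutativeRing; _-Raw-AlmostCommutative⟶_)
open import Data.Empty using (⊥)
open import Data.Fin as Fin using (Fin; zero; suc; toℕ; fromℕ; fromℕ<; inject₁; funToFin; finToFun)
open import Data.Fin.Relation.Unary.Top using (view; ‵fromℕ; ‵inject₁)
open import Data.List as List using (List; []; _∷_; length; map; filter; lookup; allFin; cartesianProduct)
open import Data.List.Extrema.Nat using (xs≤max)
open import Data.List.Membership.Propositional using (_∉_; lose) renaming (_∈_ to _∈ˡ_)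
open import Data.List.Membership.Propositional.Properties using (∈-lookup; ∈-filter⁺; ∈-filter⁻; ∈-allFin; ∈-map⁺; ∈-cartesianProduct⁻)
open import Data.List.Properties using (length-map; length-++; length-tabulate; length-filter; filter-notAll)
open import Data.List.Relation.Unary.All as All using (All; []; _∷_)
open import Data.List.Relation.Unary.AllPairs using ([]; _∷_)
open import Data.List.Relation.Unary.Any as Any using (here; there)
open import Data.List.Relation.Unary.Any.Properties using (lookup-index)
open import Data.List.Relation.Unary.Unique.Propositional using (Unique)
open import Data.Maybe using (Maybe; just; nothing)
open import Data.Nat as ℕ using (ℕ; zero; suc; _≤_; _<_; z≤n; s≤s; _∸_; NonZero)
open import Data.Nat.Coprimality using (prime⇒coprime; coprime-Bézout)
open import Data.Nat.Primality using (Prime; prime⇒nonZero; prime⇒nonTrivial)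
open import Data.Product using (_×_; _,_; proj₁; proj₂; ∃-syntax; Σ-syntax)
open import Data.Sum using (_⊎_; inj₁; inj₂)
open import Data.Vec.Functional using (Vector; init; last) renaming (_∷_ to _∷ᵛ_)
open import Function using (_∘_; id; Inverse)
open import Function.Definitions using (Bijective)
open import Level using (Level)
open import Relation.Binary.Definitions using (DecidableEquality)
open import Relation.Binary.PropositionalEquality hiding (setoid)
open import Relation.Nullary using (¬_; Dec; yes; no; contradiction)
open import Relation.Nullary.Decidable using (¬?)
open import Relation.Unary using (Pred; _∈_; Decidable)
import Algebra.Properties.CommutativeSemiring.Exp as Exp
import Algebra.Properties.Monoid.Mult as MonoidMult
import Algebra.Properties.Ring as RingProperties
import Algebra.Properties.Semiring.Mult as SemiringMult
import Algebra.Properties.Semiring.Sum as Sum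
import Algebra.Solver.Ring as RingSolver
import Data.Fin.Properties as Fin
import Data.List.Membership.DecPropositional as DecMembership
import Data.List.Relation.Unary.Unique.Propositional.Properties as Unique
import Data.Nat.DivMod as ℕ
import Data.Nat.GCD as GCD
import Data.Nat.Properties as ℕ
import Data.Nat.Tactic.RingSolver as ℕ-Solver

-- Coefficients are formal differences m - n, kept in a normal form so that the
-- solver also cancels; coefficients in an abstract ring would not compute.
module IntegralSolver {c : Level} (R : CommutativeRing c c) where

  open CommutativeRing R hiding (refl; sym; trans)
  open CommutativeRing R using () renaming (refl to ≈-refl; sym to ≈-sym; trans to ≈-trans)
  open SemiringMult semiring renaming (_×_ to _×ᴿ_; ×1-homo-* to ·1-homo-*)
  open MonoidMult +-monoid using () renaming (×-homo-+ to ·-homo-+)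
  open RingProperties ring
  open import Relation.Binary.Reasoning.Setoid setoid

  normalise : ℕ → ℕ → ℕ × ℕ
  normalise (suc m) (suc n) = normalise m n
  normalise m       n       = m , n

  coefficients : RawRing _ _
  coefficients = record
    { Carrier = ℕ × ℕ
    ; _≈_ = _≡_
    ; _+_ = λ (a , b) (x , y) → normalise (a ℕ.+ x) (b ℕ.+ y)
    ; _*_ = λ (a , b) (x , y) → normalise (a ℕ.* x ℕ.+ b ℕ.* y) (a ℕ.* y ℕ.+ b ℕ.* x)
    ; -_ = λ (a , b) → b , a
    ; 0# = 0 , 0
    ; 1# = 1 , 0
    }

  difference : ℕ × ℕ → Carrier
  difference (m , n) = m ×ᴿ 1# - n ×ᴿ 1#

  interchange : ∀ a b x y → (a + x) - (b + y) ≈ (a - b) + (x - y)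
  interchange a b x y = begin
    (a + x) + - (b + y)      ≈⟨ +-congˡ (≈-trans (-‿cong (+-comm b y)) (-‿anti-homo-+ y b)) ⟩
    (a + x) + (- b + - y)    ≈⟨ +-assoc a x _ ⟩
    a + (x + (- b + - y))    ≈⟨ +-congˡ (≈-sym (+-assoc x (- b) (- y))) ⟩
    a + ((x + - b) + - y)    ≈⟨ +-congˡ (+-congʳ (+-comm x (- b))) ⟩
    a + ((- b + x) + - y)    ≈⟨ +-congˡ (+-assoc (- b) x (- y)) ⟩
    a + (- b + (x + - y))    ≈⟨ ≈-sym (+-assoc a (- b) _) ⟩
    (a - b) + (x - y)        ∎

  difference-normalise : ∀ m n → difference (normalise m n) ≈ difference (m , n)
  difference-normalise zero    n       = ≈-refl
  difference-normalise (suc m) zero    = ≈-refl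
  difference-normalise (suc m) (suc n) = begin
    difference (normalise m n)                ≈⟨ difference-normalise m n ⟩
    m ×ᴿ 1# - n ×ᴿ 1#                      ≈⟨ +-identityˡ _ ⟨
    0# + (m ×ᴿ 1# - n ×ᴿ 1#)               ≈⟨ +-congʳ (-‿inverseʳ 1#) ⟨
    (1# - 1#) + (m ×ᴿ 1# - n ×ᴿ 1#)        ≈⟨ interchange 1# 1# _ _ ⟨
    (1# + m ×ᴿ 1#) - (1# + n ×ᴿ 1#)        ∎

  +-homo : ∀ a b x y → difference (normalise (a ℕ.+ x) (b ℕ.+ y)) ≈ difference (a , b) + difference (x , y)
  +-homo a b x y = begin
    difference (normalise (a ℕ.+ x) (b ℕ.+ y))  ≈⟨ difference-normalise (a ℕ.+ x) (b ℕ.+ y) ⟩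
    (a ℕ.+ x) ×ᴿ 1# - (b ℕ.+ y) ×ᴿ 1#        ≈⟨ +-cong (·-homo-+ 1# a x) (-‿cong (·-homo-+ 1# b y)) ⟩
    (a ×ᴿ 1# + x ×ᴿ 1#) - (b ×ᴿ 1# + y ×ᴿ 1#)  ≈⟨ interchange _ _ _ _ ⟩
    difference (a , b) + difference (x , y)          ∎

  *-homo : ∀ a b x y →
    difference (normalise (a ℕ.* x ℕ.+ b ℕ.* y) (a ℕ.* y ℕ.+ b ℕ.* x)) ≈ difference (a , b) * difference (x , y)
  *-homo a b x y = begin
    difference (normalise (a ℕ.* x ℕ.+ b ℕ.* y) (a ℕ.* y ℕ.+ b ℕ.* x))
      ≈⟨ +-homo (a ℕ.* x) (a ℕ.* y) (b ℕ.* y) (b ℕ.* x) ⟩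
    ((a ℕ.* x) ×ᴿ 1# - (a ℕ.* y) ×ᴿ 1#) + ((b ℕ.* y) ×ᴿ 1# - (b ℕ.* x) ×ᴿ 1#)
      ≈⟨ +-cong (+-cong (·1-homo-* a x) (-‿cong (·1-homo-* a y)))
                (+-cong (·1-homo-* b y) (-‿cong (·1-homo-* b x))) ⟩
    (A * X - A * Y) + (B * Y - B * X)
      ≈⟨ +-cong (x[y-z]≈xy-xz A X Y) (x[y-z]≈xy-xz B Y X) ⟨
    A * (X - Y) + B * (Y - X)
      ≈⟨ +-congˡ (*-congˡ (⁻¹-anti-homo-// X Y)) ⟨
    A * (X - Y) + B * - (X - Y)
      ≈⟨ +-congˡ (-‿distribʳ-* B (X - Y)) ⟨
    A * (X - Y) + - (B * (X - Y))
      ≈⟨ [y-z]x≈yx-zx (X - Y) A B ⟨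
    (A - B) * (X - Y) ∎
    where
    A B X Y : Carrier
    A = a ×ᴿ 1#
    B = b ×ᴿ 1#
    X = x ×ᴿ 1#
    Y = y ×ᴿ 1#

  -- The special cases make the literals con (0 , 0) and con (1 , 0) denote 0# and 1# on the nose.
  value : ℕ × ℕ → Carrier
  value (0 , 0) = 0#
  value (1 , 0) = 1#
  value x       = difference x

  value≈ : ∀ x → value x ≈ difference x
  value≈ (0 , 0)           = ≈-sym (-‿inverseʳ 0#)
  value≈ (1 , 0)           = ≈-sym (≈-trans (+-congˡ -0#≈0#) (≈-trans (+-identityʳ _) (+-identityʳ 1#)))
  value≈ (0 , suc n)       = ≈-refl
  value≈ (1 , suc n)       = ≈-refl
  value≈ (suc (suc m) , n) = ≈-refl

  morphism : coefficients -Raw-AlmostCommutative⟶ fromCommutativeRing R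
  morphism = record
    { ⟦_⟧    = value
    ; +-homo = λ (a , b) (x , y) → ≈-trans (value≈ (normalise (a ℕ.+ x) (b ℕ.+ y)))
        (≈-trans (+-homo a b x y) (≈-sym (+-cong (value≈ (a , b)) (value≈ (x , y)))))
    ; *-homo = λ (a , b) (x , y) →
        ≈-trans (value≈ (normalise (a ℕ.* x ℕ.+ b ℕ.* y) (a ℕ.* y ℕ.+ b ℕ.* x)))
        (≈-trans (*-homo a b x y) (≈-sym (*-cong (value≈ (a , b)) (value≈ (x , y)))))
    ; -‿homo = λ (a , b) → ≈-trans (value≈ (b , a))
        (≈-trans (≈-sym (⁻¹-anti-homo-// (a ×ᴿ 1#) (b ×ᴿ 1#))) (-‿cong (≈-sym (value≈ (a , b)))))
    ; 0-homo = ≈-refl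
    ; 1-homo = ≈-refl
    }

  -- Normal forms are compared as integers; coincidences due to a positive characteristic are
  -- missed, which makes the solver weaker but not unsound.
  coefficient-≟ : ∀ x y → Maybe (value x ≈ value y)
  coefficient-≟ (a , b) (x , y) with a ℕ.≟ x | b ℕ.≟ y
  ... | yes refl | yes refl = just ≈-refl
  ... | _        | _        = nothing

  open RingSolver coefficients (fromCommutativeRing R) morphism coefficient-≟ public
    using (solve; _:+_; _:*_; _:-_; :-_; _:=_; con)

-- Counting with duplicate-free lists.

private
  variable
    a ℓ : Level
    S : Set a

lookup-injective : ∀ {xs : List S} → Unique xs →
  ∀ {i j} → lookup xs i ≡ lookup xs j → i ≡ j
lookup-injective (x∉xs ∷ u) {zero}  {zero}  eq = refl
lookup-injective (x∉xs ∷ u) {zero}  {suc j} eq = contradiction eq (All.lookup x∉xs (∈-lookup j))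
lookup-injective (x∉xs ∷ u) {suc i} {zero}  eq = contradiction (sym eq) (All.lookup x∉xs (∈-lookup i))
lookup-injective (x∉xs ∷ u) {suc i} {suc j} eq = cong suc (lookup-injective u eq)

unique-length≤ : ∀ {xs : List S} {m} → Unique xs → (g : S → Fin m) →
  (∀ {x y} → x ∈ˡ xs → y ∈ˡ xs → g x ≡ g y → x ≡ y) → length xs ≤ m
unique-length≤ {xs = xs} u g g-inj = Fin.injective⇒≤ {f = g ∘ lookup xs}
  (λ {i} {j} eq → lookup-injective u (g-inj (∈-lookup i) (∈-lookup j) eq))

unique-length≤2 : ∀ {xs : List S} → Unique xs →
  (∀ {x y z} → x ∈ˡ xs → y ∈ˡ xs → z ∈ˡ xs → x ≢ y → x ≢ z → y ≢ z → ⊥) → length xs ≤ 2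
unique-length≤2 {xs = []}          u no-three = z≤n
unique-length≤2 {xs = _ ∷ []}      u no-three = s≤s z≤n
unique-length≤2 {xs = _ ∷ _ ∷ []}  u no-three = s≤s (s≤s z≤n)
unique-length≤2 {xs = x ∷ y ∷ z ∷ _} ((x≢y ∷ x≢z ∷ _) ∷ (y≢z ∷ _) ∷ _) no-three =
  contradiction (no-three (here refl) (there (here refl)) (there (there (here refl))) x≢y x≢z y≢z) λ ()

length-cartesianProduct : ∀ {b} {B : Set b} (xs : List S) (ys : List B) →
  length (cartesianProduct xs ys) ≡ length xs ℕ.* length ys
length-cartesianProduct []       ys = refl
length-cartesianProduct (x ∷ xs) ys = trans (length-++ (map (x ,_) ys))
  (cong₂ ℕ._+_ (length-map (x ,_) ys) (length-cartesianProduct xs ys))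

module _ {P : Pred S ℓ} (P? : Decidable P) where

  length-filter-split : ∀ xs → length xs ≡ length (filter P? xs) ℕ.+ length (filter (¬? ∘ P?) xs)
  length-filter-split []       = refl
  length-filter-split (x ∷ xs) with P? x
  ... | yes _ = cong suc (length-filter-split xs)
  ... | no  _ = trans (cong suc (length-filter-split xs)) (sym (ℕ.+-suc _ _))

  -- Passing to a sublist shrinks every fibre, so a uniform fibre bound survives the removal of one
  -- fibre in the induction below.
  length-filter-filter≤ : ∀ {ℓ′} {Q : Pred S ℓ′} (Q? : Decidable Q) xs →
    length (filter Q? (filter P? xs)) ≤ length (filter Q? xs)
  length-filter-filter≤ Q? []       = z≤n
  length-filter-filter≤ Q? (x ∷ xs) with P? x | Q? x in eq
  ... | yes _ | yes _ rewrite eq = s≤s (length-filter-filter≤ Q? xs)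
  ... | yes _ | no  _ rewrite eq = length-filter-filter≤ Q? xs
  ... | no  _ | yes _ = ℕ.m≤n⇒m≤1+n (length-filter-filter≤ Q? xs)
  ... | no  _ | no  _ = length-filter-filter≤ Q? xs

length≤-by-fibres : ∀ m k (g : S → ℕ) xs → (∀ {x} → x ∈ˡ xs → g x < m) →
  (∀ j → length (filter (λ x → g x ℕ.≟ j) xs) ≤ k) → length xs ≤ m ℕ.* k
length≤-by-fibres zero    k g []       g< fibre≤ = z≤n
length≤-by-fibres zero    k g (x ∷ xs) g< fibre≤ = contradiction (g< (here refl)) λ ()
length≤-by-fibres (suc m) k g xs       g< fibre≤ = begin
  length xs                                        ≡⟨ length-filter-split at-m? xs ⟩
  length (filter at-m? xs) ℕ.+ length ys             ≤⟨ ℕ.+-mono-≤ (fibre≤ m) rest ⟩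
  k ℕ.+ m ℕ.* k                                        ∎
  where
  open ℕ.≤-Reasoning
  at-m? : Decidable (λ x → g x ≡ m)
  at-m? x = g x ℕ.≟ m
  ys = filter (¬? ∘ at-m?) xs
  rest : length ys ≤ m ℕ.* k
  rest = length≤-by-fibres m k g ys
    (λ y∈ys → let y∈xs , gy≢m = ∈-filter⁻ (¬? ∘ at-m?) y∈ys in ℕ.≤∧≢⇒< (ℕ.≤-pred (g< y∈xs)) gy≢m)
    (λ j → ℕ.≤-trans (length-filter-filter≤ (¬? ∘ at-m?) (λ x → g x ℕ.≟ j) xs) (fibre≤ j))

module _ (_≟ᴬ_ : DecidableEquality S) where

  open DecMembership _≟ᴬ_ using (_∈?_)

  -- A member of `xs` lying in `ys` is sent to its position in `ys`, from which it can be looked up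
  -- again; so at most `length ys` members are lost.
  length≤-∉ : ∀ {xs} → Unique xs → ∀ ys →
    length xs ≤ length ys ℕ.+ length (filter (λ x → ¬? (x ∈? ys)) xs)
  length≤-∉ {xs} u ys = begin
    length xs                                              ≡⟨ length-filter-split (_∈? ys) xs ⟩
    length (filter (_∈? ys) xs) ℕ.+ length (filter (λ x → ¬? (x ∈? ys)) xs)
      ≤⟨ ℕ.+-monoˡ-≤ _ inside ⟩
    length ys ℕ.+ length (filter (λ x → ¬? (x ∈? ys)) xs)  ∎
    where
    open ℕ.≤-Reasoning
    in-ys : ∀ i → lookup (filter (_∈? ys) xs) i ∈ˡ ys
    in-ys i = proj₂ (∈-filter⁻ (_∈? ys) {xs = xs} (∈-lookup i))
    inside : length (filter (_∈? ys) xs) ≤ length ys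
    inside = Fin.injective⇒≤ {f = λ i → Any.index (in-ys i)} λ {i} {j} eq →
      lookup-injective (Unique.filter⁺ (_∈? ys) u)
        (trans (lookup-index (in-ys i)) (trans (cong (lookup ys) eq) (sym (lookup-index (in-ys j)))))

-- Arithmetic of finite fields, discrete logarithms and the order of a primitive element.

module FieldProperties {c : Level} {q : ℕ} (F : FiniteField c q) where

  open FiniteField F public
  open CommutativeRing commutativeRing public
    using ( +-assoc; +-comm; +-identityˡ; +-identityʳ; -‿inverseˡ; -‿inverseʳ
          ; *-assoc; *-comm; *-identityˡ; *-identityʳ; zeroˡ; zeroʳ)
  open CommutativeRing commutativeRing using (ring; semiring; commutativeSemiring)
  open Exp commutativeSemiring public using (^-homo-*; ^-assocʳ)
  open SemiringMult semiring public using (×-homo-+; ×-assocˡ; ×-comm-*; ×-assoc-*; ×-homo-1)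
  open Sum semiring public
    using (sum-cong-≗; sum-replicate; sum-replicate-zero; sum-init-last; ∑-distrib-+; sum-permute; *-distribˡ-sum)
  open RingProperties ring public
    using (-0#≈0#; x[y-z]≈xy-xz; [y-z]x≈yx-zx; +-cancelˡ; +-cancelʳ; -‿involutive; -‿distribʳ-*; +-inverseʳ-unique; +-identityˡ-unique)
    renaming (x∙y⁻¹≈ε⇒x≈y to x-y≡0⇒x≡y)
  open IntegralSolver commutativeRing public using (solve; _:+_; _:*_; _:-_; :-_; _:=_; con)
  open Inverse enumeration public renaming (to to index; from to element) using (strictlyInverseˡ; strictlyInverseʳ)
  open ≡-Reasoning

  index-injective : ∀ {x y} → index x ≡ index y → x ≡ y
  index-injective {x} {y} eq =
    trans (sym (strictlyInverseʳ x)) (trans (cong element eq) (strictlyInverseʳ y))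

  element-injective : ∀ {i j} → element i ≡ element j → i ≡ j
  element-injective {i} {j} eq =
    trans (sym (strictlyInverseˡ i)) (trans (cong index eq) (strictlyInverseˡ j))

  injective⇒q≤ : ∀ {m} (g : Carrier → Fin m) → (∀ {x y} → g x ≡ g y → x ≡ y) → q ≤ m
  injective⇒q≤ g g-inj = Fin.injective⇒≤ {f = g ∘ element} (λ eq → element-injective (g-inj eq))

  -- Pigeonhole: a missed value `y` could be added as one more image, giving an injection of q + 1
  -- points into q.
  injective⇒surjective : ∀ {g : Carrier → Carrier} → (∀ {x y} → g x ≡ g y → x ≡ y) →
    ∀ y → ∃[ x ] g x ≡ y
  injective⇒surjective {g} g-inj y with Fin.any? (λ i → g (element i) ≟ y)
  ... | yes (i , eq) = element i , eq
  ... | no  miss     = contradiction (Fin.injective⇒≤ inj) ℕ.1+n≰n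
    where
    g′ : Fin (suc q) → Fin q
    g′ zero    = index y
    g′ (suc i) = index (g (element i))
    inj : ∀ {i j} → g′ i ≡ g′ j → i ≡ j
    inj {zero}  {zero}  eq = refl
    inj {zero}  {suc j} eq = contradiction (j , sym (index-injective eq)) miss
    inj {suc i} {zero}  eq = contradiction (i , index-injective eq) miss
    inj {suc i} {suc j} eq = cong suc (element-injective (g-inj (index-injective eq)))

  elements : List Carrier
  elements = map element (allFin q)

  elements-unique : Unique elements
  elements-unique = Unique.map⁺ element-injective (Unique.allFin⁺ q)

  length-elements : length elements ≡ q
  length-elements = trans (length-map element (allFin q)) (length-tabulate {n = q} id)

  x≡0⇒x*y≡0 : ∀ {x y} → x ≡ 0# → x * y ≡ 0#
  x≡0⇒x*y≡0 {y = y} refl = zeroˡ y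

  y≡0⇒x*y≡0 : ∀ {x y} → y ≡ 0# → x * y ≡ 0#
  y≡0⇒x*y≡0 {x} refl = zeroʳ x

  *-cancelˡ : ∀ {x y z} → x ≢ 0# → x * y ≡ x * z → y ≡ z
  *-cancelˡ {x} {y} {z} x≢0 eq = begin
    y               ≡⟨ undo y ⟨
    x ⁻¹ * (x * y)  ≡⟨ cong (x ⁻¹ *_) eq ⟩
    x ⁻¹ * (x * z)  ≡⟨ undo z ⟩
    z               ∎
    where
    undo : ∀ w → x ⁻¹ * (x * w) ≡ w
    undo w = begin
      x ⁻¹ * (x * w)  ≡⟨ solve 3 (λ x x′ w → x′ :* (x :* w) := (x :* x′) :* w) refl x (x ⁻¹) w ⟩
      (x * x ⁻¹) * w  ≡⟨ cong (_* w) (*-inverseʳ x x≢0) ⟩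
      1# * w          ≡⟨ *-identityˡ w ⟩
      w               ∎

  x*y≡0⇒y≡0 : ∀ {x y} → x ≢ 0# → x * y ≡ 0# → y ≡ 0#
  x*y≡0⇒y≡0 {x} x≢0 eq = *-cancelˡ x≢0 (trans eq (sym (zeroʳ x)))

  x*y≢0 : ∀ {x y} → x ≢ 0# → y ≢ 0# → x * y ≢ 0#
  x*y≢0 x≢0 y≢0 eq = y≢0 (x*y≡0⇒y≡0 x≢0 eq)

  x^n≢0 : ∀ {x} n → x ≢ 0# → x ^ n ≢ 0#
  x^n≢0 zero    x≢0 = 1≢0
  x^n≢0 (suc n) x≢0 = x*y≢0 x≢0 (x^n≢0 n x≢0)

  1^n≡1 : ∀ n → 1# ^ n ≡ 1#
  1^n≡1 zero    = refl
  1^n≡1 (suc n) = trans (*-identityˡ _) (1^n≡1 n)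

  x-y≢0 : ∀ {x y} → x ≢ y → x - y ≢ 0#
  x-y≢0 x≢y eq = x≢y (x-y≡0⇒x≡y _ _ eq)

  ⁻¹-unique : ∀ {x y} → x * y ≡ 1# → y ≡ x ⁻¹
  ⁻¹-unique {x} {y} eq = *-cancelˡ x≢0 (trans eq (sym (*-inverseʳ x x≢0)))
    where
    x≢0 : x ≢ 0#
    x≢0 refl = 1≢0 (trans (sym eq) (zeroˡ y))

  ⁻¹≢0 : ∀ {x} → x ≢ 0# → x ⁻¹ ≢ 0#
  ⁻¹≢0 {x} x≢0 eq = 1≢0 (trans (sym (*-inverseʳ x x≢0)) (trans (cong (x *_) eq) (zeroʳ x)))

  ⁻¹-involutive : ∀ x → (x ⁻¹) ⁻¹ ≡ x
  ⁻¹-involutive x with x ≟ 0#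
  ... | yes refl = trans (cong _⁻¹ 0⁻¹≡0) 0⁻¹≡0
  ... | no  x≢0  = sym (⁻¹-unique (trans (*-comm _ _) (*-inverseʳ x x≢0)))

  sum-zero : ∀ n {t : Vector Carrier n} → (∀ i → t i ≡ 0#) → sum t ≡ 0#
  sum-zero n t≡0 = trans (sum-cong-≗ t≡0) (sum-replicate-zero n)

  module PrimitiveElement {ζ : Carrier} (ζ-primitive : IsPrimitive F ζ) where

    private
      logarithm : ∀ {y} → y ≢ 0# → ∃[ i ] ζ ^ i ≡ y
      logarithm y≢0 = proj₂ ζ-primitive _ y≢0

    ζ≢0 : ζ ≢ 0#
    ζ≢0 = proj₁ ζ-primitive

    ζ^[i%t]≡ζ^i : ∀ i t .{{_ : ℕ.NonZero t}} → ζ ^ t ≡ 1# → ζ ^ (i ℕ.% t) ≡ ζ ^ i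
    ζ^[i%t]≡ζ^i i t ζ^t≡1 = sym (begin
      ζ ^ i                                        ≡⟨ cong (ζ ^_) (ℕ.m≡m%n+[m/n]*n i t) ⟩
      ζ ^ (i ℕ.% t ℕ.+ i ℕ./ t ℕ.* t)              ≡⟨ ^-homo-* ζ (i ℕ.% t) (i ℕ./ t ℕ.* t) ⟩
      ζ ^ (i ℕ.% t) * ζ ^ (i ℕ./ t ℕ.* t)          ≡⟨ cong (λ k → ζ ^ (i ℕ.% t) * ζ ^ k) (ℕ.*-comm (i ℕ./ t) t) ⟩
      ζ ^ (i ℕ.% t) * ζ ^ (t ℕ.* (i ℕ./ t))        ≡⟨ cong (ζ ^ (i ℕ.% t) *_) (^-assocʳ ζ t (i ℕ./ t)) ⟨
      ζ ^ (i ℕ.% t) * (ζ ^ t) ^ (i ℕ./ t)          ≡⟨ cong (λ z → ζ ^ (i ℕ.% t) * z ^ (i ℕ./ t)) ζ^t≡1 ⟩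
      ζ ^ (i ℕ.% t) * 1# ^ (i ℕ./ t)               ≡⟨ cong (ζ ^ (i ℕ.% t) *_) (1^n≡1 (i ℕ./ t)) ⟩
      ζ ^ (i ℕ.% t) * 1#                           ≡⟨ *-identityʳ _ ⟩
      ζ ^ (i ℕ.% t)                                ∎)

    -- If ζ^t is 1, a nonzero element is determined by its logarithm modulo t, so there are at most
    -- t of them, and 0 makes t + 1.
    order≥ : ∀ {t} → 1 ≤ t → ζ ^ t ≡ 1# → q ≤ suc t
    order≥ {t@(suc _)} _ ζ^t≡1 = injective⇒q≤ code code-injective
      where
      code : Carrier → Fin (suc t)
      code y with y ≟ 0#
      ... | yes _   = zero
      ... | no  y≢0 = suc (proj₁ (logarithm y≢0) ℕ.mod t)
      code-injective : ∀ {x y} → code x ≡ code y → x ≡ y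
      code-injective {x} {y} eq with x ≟ 0# | y ≟ 0#
      ... | yes x≡0 | yes y≡0 = trans x≡0 (sym y≡0)
      ... | no  x≢0 | no  y≢0 = begin
        x                ≡⟨ proj₂ (logarithm x≢0) ⟨
        ζ ^ i            ≡⟨ ζ^[i%t]≡ζ^i i t ζ^t≡1 ⟨
        ζ ^ (i ℕ.% t)    ≡⟨ cong (ζ ^_) i%t≡j%t ⟩
        ζ ^ (j ℕ.% t)    ≡⟨ ζ^[i%t]≡ζ^i j t ζ^t≡1 ⟩
        ζ ^ j            ≡⟨ proj₂ (logarithm y≢0) ⟩
        y                ∎
        where
        i = proj₁ (logarithm x≢0)
        j = proj₁ (logarithm y≢0)
        i%t≡j%t : i ℕ.% t ≡ j ℕ.% t
        i%t≡j%t = trans (sym (Fin.toℕ-fromℕ< (ℕ.m%n<n i t)))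
          (trans (cong toℕ (Fin.suc-injective eq)) (Fin.toℕ-fromℕ< (ℕ.m%n<n j t)))

    ζ^i≡ζ^j⇒ζ^[j∸i]≡1 : ∀ {i j} → i ≤ j → ζ ^ i ≡ ζ ^ j → ζ ^ (j ∸ i) ≡ 1#
    ζ^i≡ζ^j⇒ζ^[j∸i]≡1 {i} {j} i≤j eq = *-cancelˡ (x^n≢0 i ζ≢0) (begin
      ζ ^ i * ζ ^ (j ∸ i)    ≡⟨ ^-homo-* ζ i (j ∸ i) ⟨
      ζ ^ (i ℕ.+ (j ∸ i))    ≡⟨ cong (ζ ^_) (ℕ.m+[n∸m]≡n i≤j) ⟩
      ζ ^ j                  ≡⟨ eq ⟨
      ζ ^ i                  ≡⟨ *-identityʳ _ ⟨
      ζ ^ i * 1#             ∎)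

    private
      -- The q + 1 pigeons are 0 and ζ^0, ..., ζ^(q-1). As 0 is not a power of ζ, two powers
      -- coincide, and their exponents differ by at most q - 1. Together with `order≥` this pins the
      -- order to q - 1.
      collision : ∃[ t ] 1 ≤ t × t < q × ζ ^ t ≡ 1#
      collision with Fin.pigeonhole (ℕ.n<1+n q) (λ { zero → index 0# ; (suc i) → index (ζ ^ toℕ i) })
      ... | zero  , suc j , _   , eq = contradiction (sym (index-injective eq)) (x^n≢0 (toℕ j) ζ≢0)
      ... | suc i , suc j , s≤s i<j , eq =
        toℕ j ∸ toℕ i , ℕ.m<n⇒0<n∸m i<j ,
        ℕ.≤-<-trans (ℕ.m∸n≤m (toℕ j) (toℕ i)) (Fin.toℕ<n j) ,
        ζ^i≡ζ^j⇒ζ^[j∸i]≡1 (ℕ.<⇒≤ i<j) (index-injective eq)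

      period : q ∸ 1 ≡ proj₁ collision
      period = let t , 1≤t , t<q , ζ^t≡1 = collision in
        ℕ.≤-antisym (ℕ.∸-monoˡ-≤ 1 (order≥ 1≤t ζ^t≡1)) (ℕ.∸-monoˡ-≤ 1 t<q)

    1≤q∸1 : 1 ≤ q ∸ 1
    1≤q∸1 = subst (1 ≤_) (sym period) (proj₁ (proj₂ collision))

    ζ^[q∸1]≡1 : ζ ^ (q ∸ 1) ≡ 1#
    ζ^[q∸1]≡1 = trans (cong (ζ ^_) period) (proj₂ (proj₂ (proj₂ collision)))

    bounded-logarithm : ∀ {y} → y ≢ 0# → ∃[ i ] i < q ∸ 1 × ζ ^ i ≡ y
    bounded-logarithm y≢0 =
      let i , ζ^i≡y = logarithm y≢0 in
      i ℕ.% (q ∸ 1) , ℕ.m%n<n i (q ∸ 1) , trans (ζ^[i%t]≡ζ^i i (q ∸ 1) ζ^[q∸1]≡1) ζ^i≡y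
      where instance
      _ : ℕ.NonZero (q ∸ 1)
      _ = ℕ.>-nonZero 1≤q∸1

    x^[q∸1]≡1 : ∀ {x} → x ≢ 0# → x ^ (q ∸ 1) ≡ 1#
    x^[q∸1]≡1 {x} x≢0 = let i , ζ^i≡x = logarithm x≢0 in begin
      x ^ (q ∸ 1)              ≡⟨ cong (_^ (q ∸ 1)) ζ^i≡x ⟨
      (ζ ^ i) ^ (q ∸ 1)        ≡⟨ ^-assocʳ ζ i (q ∸ 1) ⟩
      ζ ^ (i ℕ.* (q ∸ 1))      ≡⟨ cong (ζ ^_) (ℕ.*-comm i (q ∸ 1)) ⟩
      ζ ^ ((q ∸ 1) ℕ.* i)      ≡⟨ ^-assocʳ ζ (q ∸ 1) i ⟨
      (ζ ^ (q ∸ 1)) ^ i        ≡⟨ cong (_^ i) ζ^[q∸1]≡1 ⟩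
      1# ^ i                   ≡⟨ 1^n≡1 i ⟩
      1#                       ∎

    -- Reduces closure under inversion to closure under multiplication when 𝔽ₚ(θ) is compared with a
    -- span of powers.
    x⁻¹≡x^[q∸2] : ∀ {x} → x ≢ 0# → x ⁻¹ ≡ x ^ (q ∸ 2)
    x⁻¹≡x^[q∸2] {x} x≢0 = sym (⁻¹-unique (trans (cong (x ^_) 1+[q∸2]≡q∸1) (x^[q∸1]≡1 x≢0)))
      where
      1+[q∸2]≡q∸1 : suc (q ∸ 2) ≡ q ∸ 1
      1+[q∸2]≡q∸1 = trans (cong suc (sym (ℕ.∸-+-assoc q 1 1))) (ℕ.m+[n∸m]≡n 1≤q∸1)

  -- Translation by 1 permutes the field, so the sum S of all elements satisfies S = q · 1 + S.
  q×1≡0 : q ×ᶠ 1# ≡ 0#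
  q×1≡0 = +-identityˡ-unique (q ×ᶠ 1#) (sum element) (sym (begin
    sum element                          ≡⟨ sum-permute element shift ⟩
    sum (λ i → element (index (1# + element i)))  ≡⟨ sum-cong-≗ {q} (λ i → strictlyInverseʳ _) ⟩
    sum (λ i → 1# + element i)           ≡⟨ ∑-distrib-+ {q} (λ _ → 1#) element ⟩
    sum {q} (λ _ → 1#) + sum element     ≡⟨ cong (_+ sum element) (sum-replicate q) ⟩
    q ×ᶠ 1# + sum element                ∎))
    where
    open import Data.Fin.Permutation using (Permutation; permutation)
    shift : Permutation q q
    shift = permutation (λ i → index (1# + element i)) (λ i → index (- 1# + element i))
      (λ i → back 1# (- 1#) (-‿inverseʳ 1#) i) (λ i → back (- 1#) 1# (-‿inverseˡ 1#) i)
      where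
      back : ∀ u v → u + v ≡ 0# → ∀ i → index (u + element (index (v + element i))) ≡ i
      back u v u+v≡0 i = begin
        index (u + element (index (v + element i)))  ≡⟨ cong (λ w → index (u + w)) (strictlyInverseʳ _) ⟩
        index (u + (v + element i))                  ≡⟨ cong index (+-assoc u v _) ⟨
        index ((u + v) + element i)                  ≡⟨ cong (λ w → index (w + element i)) u+v≡0 ⟩
        index (0# + element i)                       ≡⟨ cong index (+-identityˡ _) ⟩
        index (element i)                            ≡⟨ strictlyInverseˡ i ⟩
        i                                            ∎

funToFin-injective : ∀ {m n} {f g : Fin m → Fin n} → funToFin f ≡ funToFin g → ∀ i → f i ≡ g i
funToFin-injective {f = f} {g} eq i =
  trans (sym (Fin.finToFun-funToFin f i)) (trans (cong (λ k → finToFun k i) eq) (Fin.finToFun-funToFin g i))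

finToFun-injective : ∀ {m n} {k l : Fin (n ℕ.^ m)} → (∀ i → finToFun {n} {m} k i ≡ finToFun l i) → k ≡ l
finToFun-injective {m} {n} {k} {l} eq =
  trans (sym (Fin.funToFin-finToFin {m} {n} k)) (trans (funToFin-cong {m} eq) (Fin.funToFin-finToFin {m} {n} l))
  where
  funToFin-cong : ∀ {m} {f g : Fin m → Fin n} → (∀ i → f i ≡ g i) → funToFin f ≡ funToFin g
  funToFin-cong {zero}  eq = refl
  funToFin-cong {suc m} eq = cong₂ Fin.combine (eq zero) (funToFin-cong (eq ∘ suc))

-- Characteristic p and the power basis 1, θ, ..., θ^(n-1).

module PrimeSubfield {c : Level} {q : ℕ} (F : FiniteField c q) (p : ℕ) (p-prime : Prime p) (n : ℕ) (q≡p^n : q ≡ p ℕ.^ n) where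

  open FieldProperties F public
  open ≡-Reasoning

  instance
    p-nonZero : NonZero p
    p-nonZero = prime⇒nonZero p-prime

  1<p : 1 < p
  1<p = ℕ.nonTrivial⇒n>1 p {{prime⇒nonTrivial p-prime}}

  ×≡×1* : ∀ k x → k ×ᶠ x ≡ (k ×ᶠ 1#) * x
  ×≡×1* k x = sym (trans (×-assoc-* k 1# x) (cong (k ×ᶠ_) (*-identityˡ x)))

  ×-zeroʳ : ∀ k → k ×ᶠ 0# ≡ 0#
  ×-zeroʳ k = trans (×≡×1* k 0#) (zeroʳ _)

  -- The characteristic has to be derived from the cardinality: (p · 1)^n = p^n · 1 = q · 1 = 0, and
  -- a field has no nonzero nilpotents.
  p×1≡0 : p ×ᶠ 1# ≡ 0#
  p×1≡0 with (p ×ᶠ 1#) ≟ 0#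
  ... | yes eq = eq
  ... | no  ne = contradiction
    (trans (sym (power n)) (trans (cong (_×ᶠ 1#) (sym q≡p^n)) q×1≡0)) (x^n≢0 n ne)
    where
    power : ∀ m → (p ℕ.^ m) ×ᶠ 1# ≡ (p ×ᶠ 1#) ^ m
    power zero    = ×-homo-1 1#
    power (suc m) = begin
      (p ℕ.* p ℕ.^ m) ×ᶠ 1#           ≡⟨ ×-assocˡ 1# p (p ℕ.^ m) ⟨
      p ×ᶠ ((p ℕ.^ m) ×ᶠ 1#)          ≡⟨ ×≡×1* p _ ⟩
      (p ×ᶠ 1#) * ((p ℕ.^ m) ×ᶠ 1#)   ≡⟨ cong ((p ×ᶠ 1#) *_) (power m) ⟩
      (p ×ᶠ 1#) ^ suc m               ∎

  p×x≡0 : ∀ x → p ×ᶠ x ≡ 0#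
  p×x≡0 x = trans (×≡×1* p x) (trans (cong (_* x) p×1≡0) (zeroˡ x))

  [kp]×x≡0 : ∀ k x → (k ℕ.* p) ×ᶠ x ≡ 0#
  [kp]×x≡0 k x = begin
    (k ℕ.* p) ×ᶠ x   ≡⟨ ×-assocˡ x k p ⟨
    k ×ᶠ (p ×ᶠ x)    ≡⟨ cong (k ×ᶠ_) (p×x≡0 x) ⟩
    k ×ᶠ 0#          ≡⟨ ×-zeroʳ k ⟩
    0#               ∎

  mod-× : ∀ k x → toℕ (k ℕ.mod p) ×ᶠ x ≡ k ×ᶠ x
  mod-× k x = begin
    toℕ (k ℕ.mod p) ×ᶠ x                          ≡⟨ cong (_×ᶠ x) (Fin.toℕ-fromℕ< (ℕ.m%n<n k p)) ⟩
    (k ℕ.% p) ×ᶠ x                                ≡⟨ +-identityʳ _ ⟨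
    (k ℕ.% p) ×ᶠ x + 0#                           ≡⟨ cong ((k ℕ.% p) ×ᶠ x +_) ([kp]×x≡0 (k ℕ./ p) x) ⟨
    (k ℕ.% p) ×ᶠ x + (k ℕ./ p ℕ.* p) ×ᶠ x         ≡⟨ ×-homo-+ x (k ℕ.% p) _ ⟨
    (k ℕ.% p ℕ.+ k ℕ./ p ℕ.* p) ×ᶠ x              ≡⟨ cong (_×ᶠ x) (ℕ.m≡m%n+[m/n]*n k p) ⟨
    k ×ᶠ x                                        ∎

  [p∸1]×x≡-x : ∀ x → (p ∸ 1) ×ᶠ x ≡ - x
  [p∸1]×x≡-x x = +-inverseʳ-unique x _
    (trans (cong (_×ᶠ x) (ℕ.m+[n∸m]≡n (ℕ.<⇒≤ 1<p))) (p×x≡0 x))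

  -- Independence speaks of digits only, so k - l is represented by `δ`, the residue of k + (p - l).
  -- Once `δ` is zero, adding l back modulo p recovers k = l.
  independent⇒injective : ∀ {d} {b : Vector Carrier d} → LinearlyIndependent p F b →
    ∀ {k l} → combination p F k b ≡ combination p F l b → ∀ i → k i ≡ l i
  independent⇒injective {d} {b} independent {k} {l} eq i = Fin.toℕ-injective (begin
    toℕ (k i)                                     ≡⟨ ℕ.m<n⇒m%n≡m (Fin.toℕ<n (k i)) ⟨
    toℕ (k i) ℕ.% p                               ≡⟨ ℕ.[m+n]%n≡m%n (toℕ (k i)) p ⟨
    (toℕ (k i) ℕ.+ p) ℕ.% p                       ≡⟨ cong (ℕ._% p) (k+p i) ⟨
    ((toℕ (k i) ℕ.+ (p ∸ toℕ (l i))) ℕ.+ toℕ (l i)) ℕ.% p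
      ≡⟨ ℕ.%-distribˡ-+ (toℕ (k i) ℕ.+ (p ∸ toℕ (l i))) (toℕ (l i)) p ⟩
    ((toℕ (k i) ℕ.+ (p ∸ toℕ (l i))) ℕ.% p ℕ.+ toℕ (l i) ℕ.% p) ℕ.% p
      ≡⟨ cong (λ z → (z ℕ.+ toℕ (l i) ℕ.% p) ℕ.% p)
           (trans (sym (Fin.toℕ-fromℕ< (ℕ.m%n<n _ p))) (independent δ δ≡0 i)) ⟩
    (toℕ (l i) ℕ.% p) ℕ.% p                       ≡⟨ ℕ.m%n%n≡m%n (toℕ (l i)) p ⟩
    toℕ (l i) ℕ.% p                               ≡⟨ ℕ.m<n⇒m%n≡m (Fin.toℕ<n (l i)) ⟩
    toℕ (l i)                                     ∎)
    where
    δ : Vector (Fin p) d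
    δ i = (toℕ (k i) ℕ.+ (p ∸ toℕ (l i))) ℕ.mod p
    k+p : ∀ i → (toℕ (k i) ℕ.+ (p ∸ toℕ (l i))) ℕ.+ toℕ (l i) ≡ toℕ (k i) ℕ.+ p
    k+p i = trans (ℕ.+-assoc (toℕ (k i)) _ _) (cong (toℕ (k i) ℕ.+_) (ℕ.m∸n+n≡m (ℕ.<⇒≤ (Fin.toℕ<n (l i)))))
    term : ∀ i → toℕ (δ i) ×ᶠ b i + toℕ (l i) ×ᶠ b i ≡ toℕ (k i) ×ᶠ b i
    term i = begin
      toℕ (δ i) ×ᶠ b i + toℕ (l i) ×ᶠ b i
        ≡⟨ cong (_+ toℕ (l i) ×ᶠ b i) (mod-× (toℕ (k i) ℕ.+ (p ∸ toℕ (l i))) (b i)) ⟩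
      (toℕ (k i) ℕ.+ (p ∸ toℕ (l i))) ×ᶠ b i + toℕ (l i) ×ᶠ b i
        ≡⟨ ×-homo-+ (b i) (toℕ (k i) ℕ.+ (p ∸ toℕ (l i))) (toℕ (l i)) ⟨
      ((toℕ (k i) ℕ.+ (p ∸ toℕ (l i))) ℕ.+ toℕ (l i)) ×ᶠ b i
        ≡⟨ cong (_×ᶠ b i) (k+p i) ⟩
      (toℕ (k i) ℕ.+ p) ×ᶠ b i                    ≡⟨ ×-homo-+ (b i) (toℕ (k i)) p ⟩
      toℕ (k i) ×ᶠ b i + p ×ᶠ b i                 ≡⟨ cong (toℕ (k i) ×ᶠ b i +_) (p×x≡0 (b i)) ⟩
      toℕ (k i) ×ᶠ b i + 0#                       ≡⟨ +-identityʳ _ ⟩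
      toℕ (k i) ×ᶠ b i                            ∎
    δ≡0 : combination p F δ b ≡ 0#
    δ≡0 = +-identityˡ-unique _ (combination p F l b) (begin
      combination p F δ b + combination p F l b   ≡⟨ ∑-distrib-+ (λ i → toℕ (δ i) ×ᶠ b i) _ ⟨
      sum (λ i → toℕ (δ i) ×ᶠ b i + toℕ (l i) ×ᶠ b i) ≡⟨ sum-cong-≗ term ⟩
      combination p F k b                         ≡⟨ eq ⟩
      combination p F l b                         ∎)

  module _ (θ : Carrier) where

    -- Coefficients are left unreduced; they are taken modulo p only when elements are counted.
    Span : ℕ → Carrier → Set c
    Span d x = Σ[ k ∈ Vector ℕ d ] sum {d} (λ i → k i ×ᶠ (θ ^ toℕ i)) ≡ x

    module _ {d : ℕ} where

      Span-0 : Span d 0#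
      Span-0 = (λ _ → 0) , sum-zero d (λ i → refl)

      Span-+ : ∀ {x y} → Span d x → Span d y → Span d (x + y)
      Span-+ (k , refl) (l , refl) = (λ i → k i ℕ.+ l i) ,
        trans (sum-cong-≗ {d} (λ i → ×-homo-+ (θ ^ toℕ i) (k i) (l i)))
              (∑-distrib-+ {d} (λ i → k i ×ᶠ (θ ^ toℕ i)) _)

      Span-× : ∀ k {x} → Span d x → Span d (k ×ᶠ x)
      Span-× zero    x∈ = Span-0
      Span-× (suc k) x∈ = Span-+ x∈ (Span-× k x∈)

      Span-neg : ∀ {x} → Span d x → Span d (- x)
      Span-neg {x} x∈ = subst (Span d) ([p∸1]×x≡-x x) (Span-× (p ∸ 1) x∈)

      Span-sum : ∀ {m} (t : Vector Carrier m) → (∀ i → Span d (t i)) → Span d (sum t)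
      Span-sum {zero}  t t∈ = Span-0
      Span-sum {suc m} t t∈ = Span-+ (t∈ zero) (Span-sum (t ∘ suc) (t∈ ∘ suc))

      -- k is invertible modulo p. According to the sign in Bézout's identity, b k is -1 or 1 modulo
      -- p, so b · (k · x) is - x or x.
      Span-÷ : ∀ {k x} → 0 < k → k < p → Span d (k ×ᶠ x) → Span d x
      Span-÷ {k} {x} 0<k k<p kx∈
        with coprime-Bézout (prime⇒coprime p-prime {{ℕ.>-nonZero 0<k}} k<p)
      ... | GCD.Bézout.+- a b 1+bk≡ap =
        subst (Span d) (trans (cong -_ (+-inverseʳ-unique x (b ×ᶠ (k ×ᶠ x)) zero-sum)) (-‿involutive x))
          (Span-neg (Span-× b kx∈))
        where
        zero-sum : x + b ×ᶠ (k ×ᶠ x) ≡ 0#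
        zero-sum = trans (cong (x +_) (×-assocˡ x b k)) (trans (cong (_×ᶠ x) 1+bk≡ap) ([kp]×x≡0 a x))
      ... | GCD.Bézout.-+ a b 1+ap≡bk = subst (Span d) b[kx]≡x (Span-× b kx∈)
        where
        b[kx]≡x : b ×ᶠ (k ×ᶠ x) ≡ x
        b[kx]≡x = begin
          b ×ᶠ (k ×ᶠ x)           ≡⟨ ×-assocˡ x b k ⟩
          (b ℕ.* k) ×ᶠ x          ≡⟨ cong (_×ᶠ x) 1+ap≡bk ⟨
          x + (a ℕ.* p) ×ᶠ x      ≡⟨ cong (x +_) ([kp]×x≡0 a x) ⟩
          x + 0#                  ≡⟨ +-identityʳ x ⟩
          x                       ∎

    Span-power : ∀ {d i} → i < d → Span d (θ ^ i)
    Span-power {d} i<d =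
      let k , eq = pick (λ j → θ ^ toℕ j) (fromℕ< i<d) in
      k , trans eq (cong (θ ^_) (Fin.toℕ-fromℕ< i<d))
      where
      pick : ∀ {m} (b : Vector Carrier m) j → Σ[ k ∈ Vector ℕ m ] sum (λ i → k i ×ᶠ b i) ≡ b j
      pick {suc m} b zero =
        (λ { zero → 1 ; (suc _) → 0 }) ,
        trans (cong₂ _+_ (+-identityʳ (b zero)) (sum-zero m (λ i → refl))) (+-identityʳ (b zero))
      pick {suc m} b (suc j) =
        let k , eq = pick (b ∘ suc) j in
        (λ { zero → 0 ; (suc i) → k i }) , trans (+-identityˡ _) eq

    module _ {d : ℕ} (θ^d∈ : Span d (θ ^ d)) where

      private
        power∈ : ∀ {i} → i ≤ d → Span d (θ ^ i)
        power∈ {i} i≤d with ℕ.m≤n⇒m<n∨m≡n i≤d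
        ... | inj₁ i<d  = Span-power i<d
        ... | inj₂ refl = θ^d∈

        1∈ : Span d 1#
        1∈ = power∈ z≤n

      -- Multiplication by θ shifts the powers by one; only θ^d leaves the range, and it is in the
      -- span by hypothesis. Hence the span is a subring.
      Span-θ* : ∀ {x} → Span d x → Span d (θ * x)
      Span-θ* (k , refl) = subst (Span d) (sym (trans (*-distribˡ-sum {d} θ _) (sum-cong-≗ {d} step)))
        (Span-sum (λ i → k i ×ᶠ (θ ^ suc (toℕ i))) (λ i → Span-× (k i) (power∈ (Fin.toℕ<n i))))
        where
        step : ∀ i → θ * k i ×ᶠ (θ ^ toℕ i) ≡ k i ×ᶠ (θ ^ suc (toℕ i))
        step i = ×-comm-* (k i) θ (θ ^ toℕ i)

      Span-θ^* : ∀ i {x} → Span d x → Span d (θ ^ i * x)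
      Span-θ^* zero    {x} x∈ = subst (Span d) (sym (*-identityˡ x)) x∈
      Span-θ^* (suc i) {x} x∈ = subst (Span d) (sym (*-assoc θ (θ ^ i) x)) (Span-θ* (Span-θ^* i x∈))

      Span-* : ∀ {x y} → Span d x → Span d y → Span d (x * y)
      Span-* {y = y} (k , refl) y∈ =
        subst (Span d) (sym (trans (*-comm _ y) (trans (*-distribˡ-sum {d} y _) (sum-cong-≗ {d} step))))
          (Span-sum (λ i → k i ×ᶠ (θ ^ toℕ i * y)) (λ i → Span-× (k i) (Span-θ^* (toℕ i) y∈)))
        where
        step : ∀ i → y * k i ×ᶠ (θ ^ toℕ i) ≡ k i ×ᶠ (θ ^ toℕ i * y)
        step i = trans (×-comm-* (k i) y (θ ^ toℕ i)) (cong (k i ×ᶠ_) (*-comm y _))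

      Span-^ : ∀ {x} i → Span d x → Span d (x ^ i)
      Span-^ zero    x∈ = 1∈
      Span-^ (suc i) x∈ = Span-* x∈ (Span-^ i x∈)

      Adjoin⊆Span : ∀ {ζ} → IsPrimitive F ζ → ∀ {x} → x ∈ Adjoin p F θ → Span d x
      Adjoin⊆Span ζ-primitive = go
        where
        open PrimitiveElement ζ-primitive
        go : ∀ {x} → x ∈ Adjoin p F θ → Span d x
        go (scalar k)     = Span-× (toℕ k) 1∈
        go generator      = subst (Span d) (*-identityʳ θ) (Span-θ* 1∈)
        go (add x y)      = Span-+ (go x) (go y)
        go (negate x)     = Span-neg (go x)
        go (multiply x y) = Span-* (go x) (go y)
        go (invert {x} x∈) with x ≟ 0#
        ... | yes refl = subst (Span d) (sym 0⁻¹≡0) Span-0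
        ... | no  x≢0  = subst (Span d) (sym (x⁻¹≡x^[q∸2] x≢0)) (Span-^ (q ∸ 2) (go x∈))

    -- Coefficients matter only modulo p, so a span of d powers has at most p^d elements, while the
    -- field has p^n.
    Span-everything⇒n≤d : ∀ {d} → (∀ x → Span d x) → n ≤ d
    Span-everything⇒n≤d {d} spans = ℕ.≮⇒≥ λ d<n → ℕ.<⇒≱ (ℕ.^-monoʳ-< p 1<p d<n)
      (subst (_≤ p ℕ.^ d) q≡p^n (injective⇒q≤ code code-injective))
      where
      reduced : Carrier → Fin d → Fin p
      reduced x i = proj₁ (spans x) i ℕ.mod p
      code : Carrier → Fin (p ℕ.^ d)
      code x = funToFin (reduced x)
      decode : ∀ x → sum {d} (λ i → toℕ (reduced x i) ×ᶠ (θ ^ toℕ i)) ≡ x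
      decode x = trans (sum-cong-≗ {d} (λ i → mod-× (proj₁ (spans x) i) _)) (proj₂ (spans x))
      code-injective : ∀ {x y} → code x ≡ code y → x ≡ y
      code-injective {x} {y} eq = trans (sym (decode x))
        (trans (sum-cong-≗ {d} (λ i → cong (λ k → toℕ k ×ᶠ (θ ^ toℕ i)) (funToFin-injective eq i))) (decode y))

    module _ {ζ : Carrier} (ζ-primitive : IsPrimitive F ζ) (θ-generates : ∀ x → x ∈ Adjoin p F θ) where

      -- Otherwise the span of d powers would be closed under all field operations and contain
      -- 𝔽ₚ(θ), which is the whole field.
      θ^d∉Span : ∀ {d} → d < n → ¬ Span d (θ ^ d)
      θ^d∉Span d<n θ^d∈ =
        ℕ.<⇒≱ d<n (Span-everything⇒n≤d (λ x → Adjoin⊆Span θ^d∈ ζ-primitive (θ-generates x)))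

      -- Induction on the number of powers: a nonzero leading coefficient could be divided out,
      -- placing θ^d in the span of the lower powers.
      powers-independent : ∀ {d} → d ≤ n → LinearlyIndependent p F {d} (λ i → θ ^ toℕ i)
      powers-independent {suc d} d<n k eq = coefficient-zero
        where
        lower : Carrier
        lower = sum {d} (λ i → toℕ (k (inject₁ i)) ×ᶠ (θ ^ toℕ i))
        leading : ℕ
        leading = toℕ (k (fromℕ d))
        split : lower + leading ×ᶠ (θ ^ d) ≡ 0#
        split = begin
          lower + leading ×ᶠ (θ ^ d)
            ≡⟨ cong₂ _+_ (sum-cong-≗ {d} (λ i → cong (λ j → toℕ (k (inject₁ i)) ×ᶠ (θ ^ j)) (Fin.toℕ-inject₁ i)))
                 (cong (λ j → leading ×ᶠ (θ ^ j)) (Fin.toℕ-fromℕ d)) ⟨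
          sum (init terms) + last terms   ≡⟨ sum-init-last terms ⟨
          sum terms                       ≡⟨ eq ⟩
          0#                              ∎
          where
          terms : Vector Carrier (suc d)
          terms i = toℕ (k i) ×ᶠ (θ ^ toℕ i)
        leading≡0 : leading ≡ 0
        leading≡0 with leading ℕ.≟ 0
        ... | yes eq₀ = eq₀
        ... | no  ne  = contradiction
          (Span-÷ (ℕ.n≢0⇒n>0 ne) (Fin.toℕ<n (k (fromℕ d)))
            (subst (Span d) (sym (+-inverseʳ-unique _ _ split)) (Span-neg ((λ i → toℕ (k (inject₁ i))) , refl))))
          (θ^d∉Span d<n)
        coefficient-zero : ∀ i → toℕ (k i) ≡ 0
        coefficient-zero i with view i
        ... | ‵fromℕ     = leading≡0
        ... | ‵inject₁ j = powers-independent (ℕ.<⇒≤ d<n) (k ∘ inject₁)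
          (trans (sym (+-identityʳ lower))
            (trans (cong (λ z → lower + z ×ᶠ (θ ^ d)) (sym leading≡0)) split)) j

-- Base-p digits: the integer and the field element with given digits, and carrying.

module Digits {c : Level} {q : ℕ} (F : FiniteField c q) (p : ℕ) (p-prime : Prime p) (n : ℕ) (q≡p^n : q ≡ p ℕ.^ n)
  (θ : FiniteField.Carrier F) where

  open PrimeSubfield F p p-prime n q≡p^n public
  open ≡-Reasoning

  number : ∀ {m} → Vector (Fin p) m → ℕ
  number d = Σℕ (λ i → toℕ (d i) ℕ.* p ℕ.^ toℕ i)

  vector : ∀ {m} → Vector (Fin p) m → Carrier
  vector d = combination p F d (λ i → θ ^ toℕ i)

  number-cong : ∀ {m} (d e : Vector (Fin p) m) → (∀ i → d i ≡ e i) → number d ≡ number e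
  number-cong {m} d e eq = ℕ-Sum.sum-cong-≗ {m} (λ i → cong (λ k → toℕ k ℕ.* p ℕ.^ toℕ i) (eq i))
    where module ℕ-Sum = Sum ℕ.+-*-semiring

  -- Horner's step. `number` and `vector` evaluate the same digit polynomial at p and at θ, so with
  -- `vector-suc` both can be followed in one induction on the digits.
  number-suc : ∀ {m} (d : Vector (Fin p) (suc m)) →
    number d ≡ toℕ (d zero) ℕ.+ p ℕ.* number (d ∘ suc)
  number-suc {m} d = cong₂ ℕ._+_ (ℕ.*-identityʳ (toℕ (d zero))) (sym (begin
    p ℕ.* number (d ∘ suc)
      ≡⟨ ℕ-Sum.*-distribˡ-sum {m} p _ ⟩
    Σℕ (λ i → p ℕ.* (toℕ (d (suc i)) ℕ.* p ℕ.^ toℕ i))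
      ≡⟨ ℕ-Sum.sum-cong-≗ {m} (λ i → x*yz≡y*xz p (toℕ (d (suc i))) (p ℕ.^ toℕ i)) ⟩
    Σℕ (λ i → toℕ (d (suc i)) ℕ.* p ℕ.^ suc (toℕ i)) ∎))
    where
    module ℕ-Sum = Sum ℕ.+-*-semiring
    x*yz≡y*xz : ∀ x y z → x ℕ.* (y ℕ.* z) ≡ y ℕ.* (x ℕ.* z)
    x*yz≡y*xz = ℕ-Solver.solve-∀

  vector-suc : ∀ {m} (d : Vector (Fin p) (suc m)) →
    vector d ≡ toℕ (d zero) ×ᶠ 1# + θ * vector (d ∘ suc)
  vector-suc {m} d = cong (toℕ (d zero) ×ᶠ 1# +_) (sym (trans (*-distribˡ-sum {m} θ _)
    (sum-cong-≗ {m} (λ i → ×-comm-* (toℕ (d (suc i))) θ (θ ^ toℕ i)))))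

  digits : ∀ m → ℕ → Vector (Fin p) m
  digits (suc m) x zero    = x ℕ.mod p
  digits (suc m) x (suc i) = digits m (x ℕ./ p) i

  number-digits : ∀ m {x} → x < p ℕ.^ m → number (digits m x) ≡ x
  number-digits zero    {zero}  x< = refl
  number-digits zero    {suc x} (s≤s ())
  number-digits (suc m) {x} x< = begin
    number (digits (suc m) x)                            ≡⟨ number-suc (digits (suc m) x) ⟩
    toℕ (x ℕ.mod p) ℕ.+ p ℕ.* number (digits m (x ℕ./ p))
      ≡⟨ cong₂ (λ u v → u ℕ.+ p ℕ.* v) (Fin.toℕ-fromℕ< (ℕ.m%n<n x p))
           (number-digits m (ℕ.m<n*o⇒m/o<n (subst (x <_) (ℕ.*-comm p _) x<))) ⟩
    x ℕ.% p ℕ.+ p ℕ.* (x ℕ./ p)                          ≡⟨ cong (x ℕ.% p ℕ.+_) (ℕ.*-comm p (x ℕ./ p)) ⟩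
    x ℕ.% p ℕ.+ x ℕ./ p ℕ.* p                            ≡⟨ ℕ.m≡m%n+[m/n]*n x p ⟨
    x                                                    ∎

  p∸1<p : p ∸ 1 < p
  p∸1<p = ℕ.≤-reflexive (ℕ.m+[n∸m]≡n (ℕ.<⇒≤ 1<p))

  top : Fin p
  top = fromℕ< p∸1<p

  suc-number-top : ∀ m → suc (number {m} (λ _ → top)) ≡ p ℕ.^ m
  suc-number-top zero    = refl
  suc-number-top (suc m) = begin
    suc (number {suc m} (λ _ → top))                ≡⟨ cong suc (number-suc {m} (λ _ → top)) ⟩
    suc (toℕ top ℕ.+ p ℕ.* number {m} (λ _ → top))
      ≡⟨ cong (λ t → suc (t ℕ.+ p ℕ.* number {m} (λ _ → top))) (Fin.toℕ-fromℕ< p∸1<p) ⟩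
    suc (p ∸ 1) ℕ.+ p ℕ.* number {m} (λ _ → top)
      ≡⟨ cong (ℕ._+ p ℕ.* number {m} (λ _ → top)) (ℕ.m+[n∸m]≡n (ℕ.<⇒≤ 1<p)) ⟩
    p ℕ.+ p ℕ.* number {m} (λ _ → top)              ≡⟨ ℕ.*-suc p (number {m} (λ _ → top)) ⟨
    p ℕ.* suc (number {m} (λ _ → top))              ≡⟨ cong (p ℕ.*_) (suc-number-top m) ⟩
    p ℕ.^ suc m                                     ∎

  -- Matches the prescribed value at 0: the all-(p - 1) digit vector has number p^m - 1 by
  -- `suc-number-top`, and p - 1 acts as -1.
  vector-top : ∀ m → vector {m} (λ _ → top) ≡ - sum {m} (λ i → θ ^ toℕ i)
  vector-top m = +-inverseʳ-unique _ _ (begin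
    sum {m} (λ i → θ ^ toℕ i) + vector {m} (λ _ → top)
      ≡⟨ ∑-distrib-+ {m} (λ i → θ ^ toℕ i) _ ⟨
    sum {m} (λ i → suc (toℕ top) ×ᶠ (θ ^ toℕ i))
      ≡⟨ sum-zero m (λ i → trans (cong (_×ᶠ (θ ^ toℕ i)) suc-top) (p×x≡0 (θ ^ toℕ i))) ⟩
    0# ∎)
    where
    suc-top : suc (toℕ top) ≡ p
    suc-top = trans (cong suc (Fin.toℕ-fromℕ< p∸1<p)) (ℕ.m+[n∸m]≡n (ℕ.<⇒≤ 1<p))

  -- The amount 1 + θ + ⋯ + θ^j by which the vector grows when adding 1 carries j times.
  carry : ∀ {m} → Fin m → Carrier
  carry zero    = 1#
  carry (suc j) = 1# + θ * carry j

  increment : ∀ {m} (d : Vector (Fin p) m) → suc (number d) < p ℕ.^ m →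
    Σ[ e ∈ Vector (Fin p) m ] ∃[ j ] number e ≡ suc (number d) × vector e ≡ vector d + carry {m} j
  increment {zero}  d (s≤s ())
  increment {suc m} d number< with ℕ.m≤n⇒m<n∨m≡n (Fin.toℕ<n (d zero))
  ... | inj₁ d₀+1<p = e , zero , number-e , vector-e
    where
    e : Vector (Fin p) (suc m)
    e = fromℕ< d₀+1<p ∷ᵛ (d ∘ suc)
    e₀ : toℕ (e zero) ≡ suc (toℕ (d zero))
    e₀ = Fin.toℕ-fromℕ< d₀+1<p
    number-e : number e ≡ suc (number d)
    number-e = trans (number-suc e)
      (trans (cong (ℕ._+ p ℕ.* number (d ∘ suc)) e₀) (cong suc (sym (number-suc d))))
    vector-e : vector e ≡ vector d + 1#
    vector-e = begin
      vector e                                               ≡⟨ vector-suc e ⟩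
      toℕ (e zero) ×ᶠ 1# + θ * vector (d ∘ suc)              ≡⟨ cong (λ k → k ×ᶠ 1# + θ * vector (d ∘ suc)) e₀ ⟩
      (1# + toℕ (d zero) ×ᶠ 1#) + θ * vector (d ∘ suc)
        ≡⟨ solve 3 (λ u x y → (u :+ x) :+ y := (x :+ y) :+ u) refl 1# (toℕ (d zero) ×ᶠ 1#) _ ⟩
      (toℕ (d zero) ×ᶠ 1# + θ * vector (d ∘ suc)) + 1#       ≡⟨ cong (_+ 1#) (vector-suc d) ⟨
      vector d + 1#                                          ∎
  ... | inj₂ d₀+1≡p with increment (d ∘ suc) (ℕ.*-cancelˡ-< p _ _ (subst (_< p ℕ.^ suc m) borrow number<))
    where
    borrow : suc (number d) ≡ p ℕ.* suc (number (d ∘ suc))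
    borrow = begin
      suc (number d)                                    ≡⟨ cong suc (number-suc d) ⟩
      suc (toℕ (d zero)) ℕ.+ p ℕ.* number (d ∘ suc)     ≡⟨ cong (ℕ._+ p ℕ.* number (d ∘ suc)) d₀+1≡p ⟩
      p ℕ.+ p ℕ.* number (d ∘ suc)                      ≡⟨ ℕ.*-suc p (number (d ∘ suc)) ⟨
      p ℕ.* suc (number (d ∘ suc))                      ∎
  ... | e′ , j , number-e′ , vector-e′ = e , suc j , number-e , vector-e
    where
    0F : Fin p
    0F = fromℕ< (ℕ.<-trans (s≤s z≤n) 1<p)
    0F≡0 : toℕ 0F ≡ 0
    0F≡0 = Fin.toℕ-fromℕ< (ℕ.<-trans (s≤s z≤n) 1<p)
    e : Vector (Fin p) (suc m)
    e = 0F ∷ᵛ e′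
    number-e : number e ≡ suc (number d)
    number-e = begin
      number e                                       ≡⟨ number-suc e ⟩
      toℕ 0F ℕ.+ p ℕ.* number e′                     ≡⟨ cong₂ (λ u v → u ℕ.+ p ℕ.* v) 0F≡0 number-e′ ⟩
      p ℕ.* suc (number (d ∘ suc))                   ≡⟨ ℕ.*-suc p (number (d ∘ suc)) ⟩
      p ℕ.+ p ℕ.* number (d ∘ suc)                   ≡⟨ cong (ℕ._+ p ℕ.* number (d ∘ suc)) d₀+1≡p ⟨
      suc (toℕ (d zero)) ℕ.+ p ℕ.* number (d ∘ suc)  ≡⟨ cong suc (number-suc d) ⟨
      suc (number d)                                 ∎
    vector-e : vector e ≡ vector d + (1# + θ * carry j)
    vector-e = begin
      vector e                                           ≡⟨ vector-suc e ⟩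
      toℕ 0F ×ᶠ 1# + θ * vector e′                       ≡⟨ cong₂ (λ u v → u ×ᶠ 1# + θ * v) 0F≡0 vector-e′ ⟩
      -- The vanishing digit is replaced by p · 1 = 1 + (p - 1) · 1, which restores the old digit p
      -- - 1 and exhibits the 1 gained by the carry.
      0# + θ * (vector (d ∘ suc) + carry j)              ≡⟨ cong (_+ θ * (vector (d ∘ suc) + carry j)) (p×x≡0 1#) ⟨
      p ×ᶠ 1# + θ * (vector (d ∘ suc) + carry j)         ≡⟨ cong (λ k → k ×ᶠ 1# + θ * (vector (d ∘ suc) + carry j)) d₀+1≡p ⟨
      (1# + toℕ (d zero) ×ᶠ 1#) + θ * (vector (d ∘ suc) + carry j)
        ≡⟨ solve 5 (λ u x t y z → (u :+ x) :+ t :* (y :+ z) := (x :+ t :* y) :+ (u :+ t :* z)) refl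
             1# (toℕ (d zero) ×ᶠ 1#) θ (vector (d ∘ suc)) (carry j) ⟩
      (toℕ (d zero) ×ᶠ 1# + θ * vector (d ∘ suc)) + (1# + θ * carry j)
        ≡⟨ cong (_+ (1# + θ * carry j)) (vector-suc d) ⟨
      vector d + (1# + θ * carry j)                      ∎

  -- Adding p^m touches only the leading digit, and the bound on the sum rules out an overflow, so
  -- no carry occurs. The recursion strips low digits until a single digit is left to increment.
  increment-leading : ∀ {m} (d : Vector (Fin p) (suc m)) → number d ℕ.+ p ℕ.^ m < p ℕ.^ suc m →
    Σ[ e ∈ Vector (Fin p) (suc m) ] number e ≡ number d ℕ.+ p ℕ.^ m × vector e ≡ vector d + θ ^ m
  increment-leading {zero} d number< =
    let e , j , number-e , vector-e = increment d (subst (_< p ℕ.^ 1) (ℕ.+-comm (number d) 1) number<) in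
    e , trans number-e (ℕ.+-comm 1 (number d)) ,
    trans vector-e (cong (vector d +_) (carry-0 j))
    where
    carry-0 : ∀ (j : Fin 1) → carry j ≡ 1#
    carry-0 zero = refl
  increment-leading {suc m} d number< =
    let e′ , number-e′ , vector-e′ = increment-leading (d ∘ suc) tail< in
    d zero ∷ᵛ e′ ,
    trans (number-suc (d zero ∷ᵛ e′)) (trans (cong (λ k → toℕ (d zero) ℕ.+ p ℕ.* k) number-e′) (sym number-d+)) ,
    trans (vector-suc (d zero ∷ᵛ e′)) (trans (cong (λ v → toℕ (d zero) ×ᶠ 1# + θ * v) vector-e′) (sym vector-d+))
    where
    number-d+ : number d ℕ.+ p ℕ.^ suc m ≡ toℕ (d zero) ℕ.+ p ℕ.* (number (d ∘ suc) ℕ.+ p ℕ.^ m)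
    number-d+ = trans (cong (ℕ._+ p ℕ.^ suc m) (number-suc d))
      (regroup (toℕ (d zero)) p (number (d ∘ suc)) (p ℕ.^ m))
      where
      regroup : ∀ x y z w → (x ℕ.+ y ℕ.* z) ℕ.+ y ℕ.* w ≡ x ℕ.+ y ℕ.* (z ℕ.+ w)
      regroup = ℕ-Solver.solve-∀
    tail< : number (d ∘ suc) ℕ.+ p ℕ.^ m < p ℕ.^ suc m
    tail< = ℕ.*-cancelˡ-< p _ _ (ℕ.≤-<-trans (ℕ.m≤n+m _ (toℕ (d zero)))
      (subst (_< p ℕ.^ suc (suc m)) number-d+ number<))
    vector-d+ : vector d + θ ^ suc m ≡ toℕ (d zero) ×ᶠ 1# + θ * (vector (d ∘ suc) + θ ^ m)
    vector-d+ = trans (cong (_+ θ ^ suc m) (vector-suc d))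
      (solve 4 (λ x y z w → (x :+ y :* z) :+ y :* w := x :+ y :* (z :+ w)) refl
        (toℕ (d zero) ×ᶠ 1#) θ (vector (d ∘ suc)) (θ ^ m))

-- The digit map as a map on digit vectors, and its bijectivity.

module DigitMap {c : Level} {q : ℕ} (F : FiniteField c q) (p : ℕ) (p-prime : Prime p) (n : ℕ) (q≡p^n : q ≡ p ℕ.^ n)
  (ζ θ : FiniteField.Carrier F) (ζ-primitive : IsPrimitive F ζ) (θ-generates : ∀ x → x ∈ Adjoin p F θ)
  (f : FiniteField.Carrier F → FiniteField.Carrier F) (isDigitMap : IsDigitMap p F n ζ θ f) where

  open Digits F p p-prime n q≡p^n θ public
  open PrimitiveElement ζ-primitive public
  open ≡-Reasoning

  θ-powers-independent : LinearlyIndependent p F {n} (λ i → θ ^ toℕ i)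
  θ-powers-independent = powers-independent θ ζ-primitive θ-generates ℕ.≤-refl

  f-power : ∀ (d : Vector (Fin p) n) → number d < q ∸ 1 → f (ζ ^ number d) ≡ vector d
  f-power d number< = IsDigitMap.at-power isDigitMap (number d) number< d refl

  -- 0 receives the digits of q - 1, which no nonzero element has; this choice makes
  -- `vector-digitsOf` hold at every point.
  digitsOf : Carrier → Vector (Fin p) n
  digitsOf y with y ≟ 0#
  ... | yes _   = λ _ → top
  ... | no  y≢0 = digits n (proj₁ (bounded-logarithm y≢0))

  <q∸1⇒<p^n : ∀ {x} → x < q ∸ 1 → x < p ℕ.^ n
  <q∸1⇒<p^n x< = ℕ.<-≤-trans x< (ℕ.≤-trans (ℕ.m∸n≤m q 1) (ℕ.≤-reflexive q≡p^n))

  number-digitsOf< : ∀ {y} → y ≢ 0# → number (digitsOf y) < q ∸ 1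
  number-digitsOf< {y} y≢0 with y ≟ 0#
  ... | yes y≡0 = contradiction y≡0 y≢0
  ... | no  y≢0 = let i , i< , _ = bounded-logarithm y≢0 in
    subst (_< q ∸ 1) (sym (number-digits n (<q∸1⇒<p^n i<))) i<

  ζ^digitsOf : ∀ {y} → y ≢ 0# → ζ ^ number (digitsOf y) ≡ y
  ζ^digitsOf {y} y≢0 with y ≟ 0#
  ... | yes y≡0 = contradiction y≡0 y≢0
  ... | no  y≢0 = let i , i< , ζ^i≡y = bounded-logarithm y≢0 in
    trans (cong (ζ ^_) (number-digits n (<q∸1⇒<p^n i<))) ζ^i≡y

  number-digitsOf-0 : number (digitsOf 0#) ≡ q ∸ 1
  number-digitsOf-0 with 0# ≟ 0#
  ... | yes _ = cong (_∸ 1) (trans (suc-number-top n) (sym q≡p^n))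
  ... | no ne = contradiction refl ne

  vector-digitsOf : ∀ y → vector (digitsOf y) ≡ f y
  vector-digitsOf y with y ≟ 0#
  ... | yes refl = trans (vector-top n) (sym (IsDigitMap.at-zero isDigitMap))
  ... | no  y≢0  = let i , i< , ζ^i≡y = bounded-logarithm y≢0
                       number≡ = number-digits n (<q∸1⇒<p^n i<) in begin
    vector (digits n i)           ≡⟨ f-power (digits n i) (subst (_< q ∸ 1) (sym number≡) i<) ⟨
    f (ζ ^ number (digits n i))   ≡⟨ cong (λ k → f (ζ ^ k)) number≡ ⟩
    f (ζ ^ i)                     ≡⟨ cong f ζ^i≡y ⟩
    f y                           ∎

  number-injective : ∀ {x y} → number (digitsOf x) ≡ number (digitsOf y) → x ≡ y
  number-injective {x} {y} eq = by-cases (x ≟ 0#) (y ≟ 0#)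
    where
    by-cases : Dec (x ≡ 0#) → Dec (y ≡ 0#) → x ≡ y
    by-cases (yes x≡0)  (yes y≡0)  = trans x≡0 (sym y≡0)
    by-cases (yes refl) (no y≢0)   =
      contradiction (trans (sym eq) number-digitsOf-0) (ℕ.<⇒≢ (number-digitsOf< y≢0))
    by-cases (no x≢0)   (yes refl) =
      contradiction (trans eq number-digitsOf-0) (ℕ.<⇒≢ (number-digitsOf< x≢0))
    by-cases (no x≢0)   (no y≢0)   =
      trans (sym (ζ^digitsOf x≢0)) (trans (cong (ζ ^_) eq) (ζ^digitsOf y≢0))

  f-injective : ∀ {x y} → f x ≡ f y → x ≡ y
  f-injective {x} {y} eq = number-injective (number-cong (digitsOf x) (digitsOf y)
    (independent⇒injective θ-powers-independent
      (trans (vector-digitsOf x) (trans eq (sym (vector-digitsOf y))))))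

  f-bijective : Bijective _≡_ _≡_ f
  f-bijective = f-injective , λ y →
    let x , fx≡y = injective⇒surjective f-injective y in x , λ { refl → fx≡y }

-- Weight and degree.

module Polynomials {c : Level} {q : ℕ} (F : FiniteField c q) where

  open FieldProperties F
  open ≡-Reasoning

  -- Deduces the degree bound from the weight bound. The truncation in `code` only makes it total;
  -- on the support it changes nothing.
  weight≤1+degree : ∀ P → weight F P ≤ suc (degree F P)
  weight≤1+degree P = unique-length≤ (Unique.filter⁺ (λ i → ¬? (P i ≟ 0#)) (Unique.allFin⁺ q)) code code-injective
    where
    ≤degree : ∀ {i} → i ∈ˡ support F P → toℕ i ≤ degree F P
    ≤degree i∈ = All.lookup (xs≤max 0 (List.map toℕ (support F P))) (∈-map⁺ toℕ i∈)
    code : Fin q → Fin (suc (degree F P))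
    code i = fromℕ< (s≤s (ℕ.m⊓n≤n (toℕ i) (degree F P)))
    code-injective : ∀ {i j} → i ∈ˡ support F P → j ∈ˡ support F P → code i ≡ code j → i ≡ j
    code-injective {i} {j} i∈ j∈ eq = Fin.toℕ-injective (begin
      toℕ i                       ≡⟨ ℕ.m≤n⇒m⊓n≡m (≤degree i∈) ⟨
      toℕ i ℕ.⊓ degree F P        ≡⟨ Fin.toℕ-fromℕ< _ ⟨
      toℕ (code i)                ≡⟨ cong toℕ eq ⟩
      toℕ (code j)                ≡⟨ Fin.toℕ-fromℕ< _ ⟩
      toℕ j ℕ.⊓ degree F P        ≡⟨ ℕ.m≤n⇒m⊓n≡m (≤degree j∈) ⟩
      toℕ j                       ∎)

  -- The product of the factors w - z e. Applied to the shift operator, it multiplies the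
  -- coefficient of a node w by its value at w, and a constant sequence by its value at `1#`.
  annihilator : ∀ {m} → Vector Carrier m → List (Fin m) → Carrier → Carrier
  annihilator z []       w = 1#
  annihilator z (e ∷ es) w = (w - z e) * annihilator z es w

  annihilator≡0 : ∀ {m} (z : Vector Carrier m) {es e} → e ∈ˡ es → annihilator z es (z e) ≡ 0#
  annihilator≡0 z {_} {e} (here refl) = x≡0⇒x*y≡0 (-‿inverseʳ (z e))
  annihilator≡0 z         (there e∈)  = y≡0⇒x*y≡0 (annihilator≡0 z e∈)

  annihilator≢0 : ∀ {m} (z : Vector Carrier m) {es w} → All (λ e → w ≢ z e) es → annihilator z es w ≢ 0#
  annihilator≢0 z []           = 1≢0
  annihilator≢0 z (w≢ze ∷ w≢) = x*y≢0 (x-y≢0 w≢ze) (annihilator≢0 z w≢)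

  -- The difference operator T ↦ (x ↦ T (1 + x) - z e T x) removes the node z e from an
  -- exponential sum and costs one of the N identities.
  annihilate : ∀ {m N} (b z : Vector Carrier m) κ →
    (∀ x → x < N → sum (λ i → b i * z i ^ x) ≡ κ) →
    ∀ es x → x ℕ.+ length es < N →
    sum (λ i → b i * annihilator z es (z i) * z i ^ x) ≡ κ * annihilator z es 1#
  annihilate {m} {N} b z κ identities [] x x< = begin
    sum (λ i → b i * 1# * z i ^ x)   ≡⟨ sum-cong-≗ {m} (λ i → cong (_* z i ^ x) (*-identityʳ (b i))) ⟩
    sum (λ i → b i * z i ^ x)        ≡⟨ identities x (subst (_< N) (ℕ.+-identityʳ x) x<) ⟩
    κ                                ≡⟨ *-identityʳ κ ⟨
    κ * 1#                           ∎
  annihilate {m} {N} b z κ identities (e ∷ es) x x< = begin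
    sum (λ i → b i * ((z i - z e) * A i) * z i ^ x)
      ≡⟨ sum-cong-≗ {m} (λ i → solve 5 (λ b zi ze A P →
           b :* ((zi :- ze) :* A) :* P := b :* A :* (zi :* P) :+ :- ze :* (b :* A :* P)) refl
           (b i) (z i) (z e) (A i) (z i ^ x)) ⟩
    sum (λ i → b i * A i * z i ^ suc x + - z e * (b i * A i * z i ^ x))
      ≡⟨ ∑-distrib-+ {m} (λ i → b i * A i * z i ^ suc x) _ ⟩
    sum (λ i → b i * A i * z i ^ suc x) + sum (λ i → - z e * (b i * A i * z i ^ x))
      ≡⟨ cong (sum (λ i → b i * A i * z i ^ suc x) +_) (*-distribˡ-sum {m} (- z e) _) ⟨
    sum (λ i → b i * A i * z i ^ suc x) + - z e * sum (λ i → b i * A i * z i ^ x)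
      ≡⟨ cong₂ (λ s t → s + - z e * t)
           (annihilate b z κ identities es (suc x) 1+x<)
           (annihilate b z κ identities es x (ℕ.<-trans (ℕ.n<1+n _) 1+x<)) ⟩
    κ * A₁ + - z e * (κ * A₁)
      ≡⟨ solve 3 (λ κ A z → κ :* A :+ :- z :* (κ :* A) := κ :* ((con (1 , 0) :- z) :* A)) refl κ A₁ (z e) ⟩
    κ * ((1# - z e) * A₁) ∎
    where
    A : Fin m → Carrier
    A i = annihilator z es (z i)
    A₁ = annihilator z es 1#
    1+x< : suc x ℕ.+ length es < N
    1+x< = subst (_< N) (ℕ.+-suc x (length es)) x<

module DigitMapPolynomial {c : Level} {q : ℕ} (F : FiniteField c q) (p : ℕ) (p-prime : Prime p) (m : ℕ) (q≡p^n : q ≡ p ℕ.^ suc m)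
  (ζ θ : FiniteField.Carrier F) (ζ-primitive : IsPrimitive F ζ) (θ-generates : ∀ x → x ∈ Adjoin p F θ)
  (f : FiniteField.Carrier F → FiniteField.Carrier F) (isDigitMap : IsDigitMap p F (suc m) ζ θ f)
  (P : Polynomial F) (represents : Represents F P f) where

  open DigitMap F p p-prime (suc m) q≡p^n ζ θ ζ-primitive θ-generates f isDigitMap
  open Polynomials F
  open ≡-Reasoning

  f-shift : ∀ x → x ℕ.+ p ℕ.^ m < q ∸ 1 → f (ζ ^ (x ℕ.+ p ℕ.^ m)) ≡ f (ζ ^ x) + θ ^ m
  f-shift x x+p^m< =
    let d = digits (suc m) x
        number-d = number-digits (suc m) {x} (<q∸1⇒<p^n x<)
        e , number-e , vector-e = increment-leading d
          (subst (λ k → k ℕ.+ p ℕ.^ m < p ℕ.^ suc m) (sym number-d) (<q∸1⇒<p^n x+p^m<))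
        number-e′ = trans number-e (cong (ℕ._+ p ℕ.^ m) number-d)
    in begin
    f (ζ ^ (x ℕ.+ p ℕ.^ m))   ≡⟨ cong (λ k → f (ζ ^ k)) number-e′ ⟨
    f (ζ ^ number e)          ≡⟨ f-power e (subst (_< q ∸ 1) (sym number-e′) x+p^m<) ⟩
    vector e                  ≡⟨ vector-e ⟩
    vector d + θ ^ m          ≡⟨ cong (_+ θ ^ m) (f-power d (subst (_< q ∸ 1) (sym number-d) x<)) ⟨
    f (ζ ^ number d) + θ ^ m  ≡⟨ cong (λ k → f (ζ ^ k) + θ ^ m) number-d ⟩
    f (ζ ^ x) + θ ^ m         ∎
    where
    x< : x < q ∸ 1
    x< = ℕ.≤-<-trans (ℕ.m≤m+n x (p ℕ.^ m)) x+p^m<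

  node : Fin q → Carrier
  node i = ζ ^ toℕ i

  coefficient : Fin q → Carrier
  coefficient i = P i * (node i ^ (p ℕ.^ m) - 1#)

  exponential-sum : ∀ x → x < q ∸ 1 ∸ p ℕ.^ m → sum (λ i → coefficient i * node i ^ x) ≡ θ ^ m
  exponential-sum x x< = +-cancelˡ (f (ζ ^ x)) _ _ (begin
    f (ζ ^ x) + sum (λ i → coefficient i * node i ^ x)
      ≡⟨ cong (_+ sum (λ i → coefficient i * node i ^ x)) (represents (ζ ^ x)) ⟨
    sum (λ i → P i * (ζ ^ x) ^ toℕ i) + sum (λ i → coefficient i * node i ^ x)
      ≡⟨ ∑-distrib-+ {q} _ _ ⟨
    sum (λ i → P i * (ζ ^ x) ^ toℕ i + coefficient i * node i ^ x)
      ≡⟨ sum-cong-≗ {q} term ⟩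
    sum (λ i → P i * (ζ ^ (x ℕ.+ p ℕ.^ m)) ^ toℕ i)
      ≡⟨ represents (ζ ^ (x ℕ.+ p ℕ.^ m)) ⟩
    f (ζ ^ (x ℕ.+ p ℕ.^ m))
      ≡⟨ f-shift x x+p^m< ⟩
    f (ζ ^ x) + θ ^ m ∎)
    where
    x+p^m< : x ℕ.+ p ℕ.^ m < q ∸ 1
    x+p^m< = ℕ.≰⇒> λ ≤x+p^m → ℕ.<⇒≱ x< (ℕ.m≤n+o⇒m∸n≤o (q ∸ 1) (p ℕ.^ m) (subst (q ∸ 1 ≤_) (ℕ.+-comm x _) ≤x+p^m))
    ^-swap : ∀ k i → (ζ ^ k) ^ i ≡ (ζ ^ i) ^ k
    ^-swap k i = trans (^-assocʳ ζ k i) (trans (cong (ζ ^_) (ℕ.*-comm k i)) (sym (^-assocʳ ζ i k)))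
    term : ∀ i → P i * (ζ ^ x) ^ toℕ i + coefficient i * node i ^ x ≡ P i * (ζ ^ (x ℕ.+ p ℕ.^ m)) ^ toℕ i
    term i = begin
      P i * (ζ ^ x) ^ toℕ i + coefficient i * node i ^ x
        ≡⟨ cong (λ w → P i * w + coefficient i * node i ^ x) (^-swap x (toℕ i)) ⟩
      P i * node i ^ x + P i * (node i ^ (p ℕ.^ m) - 1#) * node i ^ x
        ≡⟨ solve 3 (λ P u v → P :* u :+ P :* (v :- con (1 , 0)) :* u := P :* (u :* v)) refl
             (P i) (node i ^ x) (node i ^ (p ℕ.^ m)) ⟩
      P i * (node i ^ x * node i ^ (p ℕ.^ m))
        ≡⟨ cong (P i *_) (^-homo-* (node i) x (p ℕ.^ m)) ⟨
      P i * node i ^ (x ℕ.+ p ℕ.^ m)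
        ≡⟨ cong (P i *_) (^-swap (toℕ i) (x ℕ.+ p ℕ.^ m)) ⟩
      P i * (ζ ^ (x ℕ.+ p ℕ.^ m)) ^ toℕ i ∎

  -- The node 1 cannot be put among the annihilated ones, since the right-hand side would be
  -- annihilated too. Here it drops out beforehand.
  trivial-node : ∀ {i} → node i ≡ 1# → coefficient i ≡ 0#
  trivial-node {i} eq = begin
    P i * (node i ^ (p ℕ.^ m) - 1#)   ≡⟨ cong (λ w → P i * (w ^ (p ℕ.^ m) - 1#)) eq ⟩
    P i * (1# ^ (p ℕ.^ m) - 1#)       ≡⟨ cong (λ w → P i * (w - 1#)) (1^n≡1 (p ℕ.^ m)) ⟩
    P i * (1# - 1#)                   ≡⟨ y≡0⇒x*y≡0 (-‿inverseʳ 1#) ⟩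
    0#                                ∎

  θ^m≢0 : θ ^ m ≢ 0#
  θ^m≢0 eq = θ^d∉Span θ ζ-primitive θ-generates (ℕ.n<1+n m) (subst (Span θ m) (sym eq) (Span-0 θ))

  -- All digits of 0 are p - 1 ≠ 0, so their combination of independent powers is nonzero.
  f0≢0 : f 0# ≢ 0#
  f0≢0 f0≡0 = ℕ.<⇒≢ (ℕ.m<n⇒0<n∸m 1<p) (trans
    (sym (θ-powers-independent (λ _ → top) (trans (vector-top (suc m)) (trans (sym (IsDigitMap.at-zero isDigitMap)) f0≡0)) zero))
    (Fin.toℕ-fromℕ< p∸1<p))

  private
    nontrivial? : Decidable (λ i → node i ≢ 1#)
    nontrivial? i = ¬? (node i ≟ 1#)

  constant-index : Fin q
  constant-index = fromℕ< (ℕ.≤-trans 1≤q∸1 (ℕ.m∸n≤m q 1))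

  toℕ-constant-index : toℕ constant-index ≡ 0
  toℕ-constant-index = Fin.toℕ-fromℕ< _

  constant-term≢0 : P constant-index ≢ 0#
  constant-term≢0 P₀≡0 = f0≢0 (trans (sym (represents 0#)) (sum-zero q terms≡0))
    where
    terms≡0 : ∀ i → P i * 0# ^ toℕ i ≡ 0#
    terms≡0 i with toℕ i in eq
    ... | suc k = y≡0⇒x*y≡0 (zeroˡ _)
    ... | zero  = x≡0⇒x*y≡0
      (trans (cong P (Fin.toℕ-injective (trans eq (sym toℕ-constant-index)))) P₀≡0)

  weight≥ : q ∸ p ℕ.^ m ≤ weight F P
  weight≥ = ℕ.≮⇒≥ λ weight< →
    -- At x = 0 every term on the left vanishes after annihilation, whereas the right is θ^m times
    -- the annihilator at `1#`, which is nonzero because no listed node is 1.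
    x*y≢0 θ^m≢0 (annihilator≢0 node (All.tabulate (λ e∈ 1≡ → proj₂ (∈-filter⁻ nontrivial? {xs = support F P} e∈) (sym 1≡))))
      (trans (sym (annihilate coefficient node (θ ^ m) exponential-sum nodes 0 (few-nodes weight<)))
        (sum-zero q (λ i → x≡0⇒x*y≡0 (vanishes i))))
    where
    nodes : List (Fin q)
    nodes = filter nontrivial? (support F P)
    -- Annihilation costs one identity per node and must leave one over, so fewer than q - 1 - p^m
    -- nodes are allowed. `constant-index` is in the support but has node 1, hence there are at most
    -- weight - 1 nodes.
    few-nodes : weight F P < q ∸ p ℕ.^ m → length nodes < q ∸ 1 ∸ p ℕ.^ m
    few-nodes weight< = ℕ.≤-trans
      (filter-notAll nontrivial? (support F P) (lose (∈-filter⁺ (λ i → ¬? (P i ≟ 0#)) (∈-allFin constant-index) constant-term≢0)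
        (λ ≢1 → ≢1 (cong (ζ ^_) toℕ-constant-index))))
      (ℕ.≤-trans (ℕ.∸-monoˡ-≤ 1 weight<)
        (ℕ.≤-reflexive (trans (ℕ.∸-+-assoc q (p ℕ.^ m) 1)
          (trans (cong (q ∸_) (ℕ.+-comm (p ℕ.^ m) 1)) (sym (ℕ.∸-+-assoc q 1 (p ℕ.^ m)))))))
    vanishes : ∀ i → coefficient i * annihilator node nodes (node i) ≡ 0#
    vanishes i with node i ≟ 1# | P i ≟ 0#
    ... | yes eq | _      = x≡0⇒x*y≡0 (trivial-node eq)
    ... | no  ne | yes Pi≡0 = x≡0⇒x*y≡0 (x≡0⇒x*y≡0 Pi≡0)
    ... | no  ne | no  Pi≢0 = y≡0⇒x*y≡0
      (annihilator≡0 node (∈-filter⁺ nontrivial? (∈-filter⁺ (λ i → ¬? (P i ≟ 0#)) (∈-allFin i) Pi≢0) ne))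

-- Additive index.

module AdditiveIndex {c : Level} {q : ℕ} (F : FiniteField c q) (p : ℕ) (p-prime : Prime p) (n : ℕ) (q≡p^n : q ≡ p ℕ.^ n)
  (ζ θ : FiniteField.Carrier F) (ζ-primitive : IsPrimitive F ζ) (θ-generates : ∀ x → x ∈ Adjoin p F θ)
  (f : FiniteField.Carrier F → FiniteField.Carrier F) (isDigitMap : IsDigitMap p F n ζ θ f) where

  open DigitMap F p p-prime n q≡p^n ζ θ ζ-primitive θ-generates f isDigitMap
  open ≡-Reasoning

  -- Two points escape the carrying rule: y = 0, which has no logarithm, and y = ζ^(q-2), where the
  -- exponent wraps around to 0. Elsewhere the increment carries j times with j < n.
  differences : Fin (2 ℕ.+ n) → Carrier
  differences zero          = f (ζ * 0#) - f 0#
  differences (suc zero)    = f (ζ * ζ ^ (q ∸ 2)) - f (ζ ^ (q ∸ 2))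
  differences (suc (suc j)) = carry j

  f-step : ∀ y → ∃[ j ] f (ζ * y) - f y ≡ differences j
  f-step y = by-cases (y ≟ 0#)
    where
    d : Vector (Fin p) n
    d = digitsOf y
    by-cases : Dec (y ≡ 0#) → ∃[ j ] f (ζ * y) - f y ≡ differences j
    by-cases (yes refl) = zero , refl
    by-cases (no y≢0) with ℕ.m≤n⇒m<n∨m≡n (number-digitsOf< y≢0)
    ... | inj₂ 1+number≡q∸1 = suc zero , cong (λ y → f (ζ * y) - f y)
      (trans (sym (ζ^digitsOf y≢0)) (cong (ζ ^_) (trans (cong (_∸ 1) 1+number≡q∸1) (ℕ.∸-+-assoc q 1 1))))
    ... | inj₁ 1+number<q∸1 with e , j , number-e , vector-e ← increment d (<q∸1⇒<p^n 1+number<q∸1) =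
      suc (suc j) , (begin
        f (ζ * y) - f y                    ≡⟨ cong (λ w → f (ζ * w) - f y) (ζ^digitsOf y≢0) ⟨
        f (ζ ^ suc (number d)) - f y       ≡⟨ cong (λ k → f (ζ ^ k) - f y) number-e ⟨
        f (ζ ^ number e) - f y             ≡⟨ cong (_- f y) (f-power e (subst (_< q ∸ 1) (sym number-e) 1+number<q∸1)) ⟩
        vector e - f y                     ≡⟨ cong₂ _-_ vector-e (sym (vector-digitsOf y)) ⟩
        (vector d + carry j) - vector d    ≡⟨ solve 2 (λ x y → (x :+ y) :- x := y) refl (vector d) (carry j) ⟩
        carry j                            ∎)

  combination∈ : ∀ {U : Pred Carrier c} → IsSubspace p F U → ∀ {d} k (b : Vector Carrier d) →
    (∀ i → b i ∈ U) → combination p F k b ∈ U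
  combination∈ sub {zero}  k b b∈ = IsSubspace.0∈ sub
  combination∈ sub {suc d} k b b∈ =
    IsSubspace.+-closed sub (IsSubspace.·-closed sub (k zero) (b∈ zero)) (combination∈ sub (k ∘ suc) (b ∘ suc) (b∈ ∘ suc))

  -- For u ∈ U the point x = u / (ζ - 1) satisfies x + u = ζ x, so M u = f (ζ x) - f x
  -- is one of the n + 2 differences; and M is injective on U because f is.
  p^dim≤2+n : ∀ {k} → CodimensionAtMost p F n f k → p ℕ.^ (n ∸ k) ≤ 2 ℕ.+ n
  p^dim≤2+n {k} (_ , M , U , M-linear , U-subspace , (b , b∈U , b-independent , _) , constant) =
    by-cases (ζ ≟ 1#)
    where
    f-translate : ∀ x {u} → u ∈ U → f (x + u) - f x ≡ M u
    f-translate x {u} u∈U = begin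
      f (x + u) - f x
        ≡⟨ solve 3 (λ a b m → a :- b := (a :- m) :+ (m :- b)) refl (f (x + u)) (f x) (M (x + u)) ⟩
      (f (x + u) - M (x + u)) + (M (x + u) - f x)
        ≡⟨ cong (_+ (M (x + u) - f x)) (constant (x + u) x
             (subst U (solve 2 (λ x u → u := (x :+ u) :- x) refl x u) u∈U)) ⟩
      (f x - M x) + (M (x + u) - f x)
        ≡⟨ cong (λ w → (f x - M x) + (w - f x)) (IsLinear.additive M-linear x u) ⟩
      (f x - M x) + ((M x + M u) - f x)
        ≡⟨ solve 3 (λ a m v → (a :- m) :+ ((m :+ v) :- a) := v) refl (f x) (M x) (M u) ⟩
      M u ∎

    M-injective : ∀ {u v} → u ∈ U → v ∈ U → M u ≡ M v → u ≡ v
    M-injective {u} {v} u∈U v∈U eq = +-cancelˡ 0# u v (f-injective (+-cancelʳ (- f 0#) _ _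
      (trans (f-translate 0# u∈U) (trans eq (sym (f-translate 0# v∈U))))))

    by-cases : Dec (ζ ≡ 1#) → p ℕ.^ (n ∸ k) ≤ 2 ℕ.+ n
    -- ζ - 1 is not invertible here, but ζ = 1 forces q ≤ 2, and p^(n-k) ≤ q suffices.
    by-cases (yes ζ≡1) = ℕ.≤-trans (ℕ.^-monoʳ-≤ p (ℕ.m∸n≤m n k))
      (ℕ.≤-trans (subst (_≤ 2) q≡p^n (order≥ {1} (s≤s z≤n) (trans (*-identityʳ ζ) ζ≡1))) (ℕ.m≤m+n 2 n))
    by-cases (no ζ≢1) = Fin.injective⇒≤ {f = code} λ {κ} {λ′} eq →
      finToFun-injective {n ∸ k} (independent⇒injective b-independent
        (M-injective (u∈U κ) (u∈U λ′) (trans (M-u κ) (trans (cong differences eq) (sym (M-u λ′))))))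
      where
      u : Fin (p ℕ.^ (n ∸ k)) → Carrier
      u κ = combination p F (finToFun κ) b
      u∈U : ∀ κ → u κ ∈ U
      u∈U κ = combination∈ U-subspace (finToFun κ) b b∈U
      base : Fin (p ℕ.^ (n ∸ k)) → Carrier
      base κ = (ζ - 1#) ⁻¹ * u κ
      ζ*base : ∀ κ → ζ * base κ ≡ base κ + u κ
      ζ*base κ = begin
        ζ * base κ
          ≡⟨ solve 3 (λ z i u → z :* (i :* u) := i :* u :+ ((z :- con (1 , 0)) :* i) :* u) refl ζ ((ζ - 1#) ⁻¹) (u κ) ⟩
        base κ + ((ζ - 1#) * (ζ - 1#) ⁻¹) * u κ
          ≡⟨ cong (λ w → base κ + w * u κ) (*-inverseʳ (ζ - 1#) (x-y≢0 ζ≢1)) ⟩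
        base κ + 1# * u κ
          ≡⟨ cong (base κ +_) (*-identityˡ (u κ)) ⟩
        base κ + u κ ∎
      code : Fin (p ℕ.^ (n ∸ k)) → Fin (2 ℕ.+ n)
      code κ = proj₁ (f-step (base κ))
      M-u : ∀ κ → M (u κ) ≡ differences (code κ)
      M-u κ = begin
        M (u κ)                            ≡⟨ f-translate (base κ) (u∈U κ) ⟨
        f (base κ + u κ) - f (base κ)      ≡⟨ cong (λ w → f w - f (base κ)) (ζ*base κ) ⟨
        f (ζ * base κ) - f (base κ)        ≡⟨ proj₂ (f-step (base κ)) ⟩
        differences (code κ)               ∎

  additive-index≥ : ∀ m → IsAdditiveIndex p F n f m → p ℕ.^ n ≤ (n ℕ.+ 2) ℕ.* m
  additive-index≥ _ (k , (at-most@(k≤n , _) , _) , refl) =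
    ℕ.≤-trans (ℕ.≤-reflexive split) (ℕ.≤-trans (ℕ.*-monoˡ-≤ (p ℕ.^ k) (p^dim≤2+n at-most))
      (ℕ.≤-reflexive (cong (ℕ._* p ℕ.^ k) (ℕ.+-comm 2 n))))
    where
    split : p ℕ.^ n ≡ p ℕ.^ (n ∸ k) ℕ.* p ℕ.^ k
    split = trans (cong (p ℕ.^_) (sym (ℕ.m∸n+n≡m k≤n))) (ℕ.^-distribˡ-+-* p (n ∸ k) k)

-- Fractional linear maps and the quadratic equation for equal shifts.

module Möbius {c : Level} {q : ℕ} (F : FiniteField c q) where

  open FieldProperties F
  open ≡-Reasoning

  record Transformation : Set c where
    field
      α β γ δ       : Carrier
      nondegenerate : α * δ ≢ β * γ

  -- g x = (α x + β) / (γ x + δ), with the denominator cleared.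
  Agrees : Transformation → (Carrier → Carrier) → Carrier → Set c
  Agrees T g x = g x * (γ * x + δ) ≡ α * x + β
    where open Transformation T

  generator-injective : ∀ g {x y} → ⟦_⟧ F g x ≡ ⟦_⟧ F g y → x ≡ y
  generator-injective (affine α β α≢0) eq = *-cancelˡ α≢0 (+-cancelʳ β _ _ eq)
  generator-injective inversion {x} {y} eq =
    trans (sym (⁻¹-involutive x)) (trans (cong _⁻¹ eq) (⁻¹-involutive y))

  compose-injective : ∀ gs {x y} → compose F gs x ≡ compose F gs y → x ≡ y
  compose-injective []       eq = eq
  compose-injective (g ∷ gs) eq = compose-injective gs (generator-injective g eq)

  -- Affine maps act on the numerator and keep every agreement. Inversion exchanges numerator and
  -- denominator, which is legitimate wherever the inner composition is nonzero; that composition is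
  -- a permutation, so each inversion adds just one pole.
  transform : ∀ gs → Σ[ T ∈ Transformation ] Σ[ poles ∈ List Carrier ]
    length poles ≤ inversions F gs × (∀ x → x ∉ poles → Agrees T (compose F gs) x)
  transform [] =
    record { α = 1# ; β = 0# ; γ = 0# ; δ = 1# ; nondegenerate = λ eq → 1≢0 (trans (sym (*-identityˡ 1#)) (trans eq (zeroˡ 0#))) } ,
    [] , z≤n ,
    λ x _ → solve 1 (λ x → x :* (con (0 , 0) :* x :+ con (1 , 0)) := con (1 , 0) :* x :+ con (0 , 0)) refl x
  transform (affine μ ν μ≢0 ∷ gs) with transform gs
  ... | T , poles , few , agrees =
    record { α = μ * α + ν * γ ; β = μ * β + ν * δ ; γ = γ ; δ = δ ; nondegenerate = nondegenerate′ } ,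
    poles , few , λ x x∉ → begin
      (μ * g x + ν) * (γ * x + δ)
        ≡⟨ solve 5 (λ μ ν g u v → (μ :* g :+ ν) :* (u :+ v) := μ :* (g :* (u :+ v)) :+ ν :* (u :+ v)) refl μ ν (g x) (γ * x) δ ⟩
      μ * (g x * (γ * x + δ)) + ν * (γ * x + δ)
        ≡⟨ cong (λ w → μ * w + ν * (γ * x + δ)) (agrees x x∉) ⟩
      μ * (α * x + β) + ν * (γ * x + δ)
        ≡⟨ solve 7 (λ μ ν α β γ δ x → μ :* (α :* x :+ β) :+ ν :* (γ :* x :+ δ)
             := (μ :* α :+ ν :* γ) :* x :+ (μ :* β :+ ν :* δ)) refl μ ν α β γ δ x ⟩
      (μ * α + ν * γ) * x + (μ * β + ν * δ) ∎
    where
    open Transformation T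
    g : Carrier → Carrier
    g = compose F gs
    nondegenerate′ : (μ * α + ν * γ) * δ ≢ (μ * β + ν * δ) * γ
    nondegenerate′ eq = nondegenerate (*-cancelˡ μ≢0 (+-cancelʳ (ν * γ * δ) _ _ (begin
      μ * (α * δ) + ν * γ * δ
        ≡⟨ solve 5 (λ μ ν α γ δ → μ :* (α :* δ) :+ ν :* γ :* δ := (μ :* α :+ ν :* γ) :* δ) refl μ ν α γ δ ⟩
      (μ * α + ν * γ) * δ
        ≡⟨ eq ⟩
      (μ * β + ν * δ) * γ
        ≡⟨ solve 5 (λ μ ν β γ δ → (μ :* β :+ ν :* δ) :* γ := μ :* (β :* γ) :+ ν :* γ :* δ) refl μ ν β γ δ ⟩
      μ * (β * γ) + ν * γ * δ ∎)))
  transform (inversion ∷ gs) with transform gs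
  ... | T , poles , few , agrees =
    record { α = γ ; β = δ ; γ = α ; δ = β ; nondegenerate = λ eq → nondegenerate (sym (trans (*-comm β γ) (trans eq (*-comm δ α)))) } ,
    pole ∷ poles , s≤s few , λ x x∉ → begin
      (g x) ⁻¹ * (α * x + β)                ≡⟨ cong ((g x) ⁻¹ *_) (agrees x (x∉ ∘ there)) ⟨
      (g x) ⁻¹ * (g x * (γ * x + δ))        ≡⟨ solve 3 (λ i g w → i :* (g :* w) := (g :* i) :* w) refl ((g x) ⁻¹) (g x) (γ * x + δ) ⟩
      (g x * (g x) ⁻¹) * (γ * x + δ)        ≡⟨ cong (_* (γ * x + δ)) (*-inverseʳ (g x) (g≢0 (x∉ ∘ here))) ⟩
      1# * (γ * x + δ)                      ≡⟨ *-identityˡ _ ⟩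
      γ * x + δ                             ∎
    where
    open Transformation T
    g : Carrier → Carrier
    g = compose F gs
    g⁻¹0 : ∃[ x ] g x ≡ 0#
    g⁻¹0 = injective⇒surjective (compose-injective gs) 0#
    pole : Carrier
    pole = proj₁ g⁻¹0
    g≢0 : ∀ {x} → x ≢ pole → g x ≢ 0#
    g≢0 x≢pole gx≡0 = x≢pole (compose-injective gs (trans gx≡0 (sym (proj₂ g⁻¹0))))

  quadratic : Carrier → Carrier → Carrier → Carrier → Carrier
  quadratic A B C x = A * (x * x) + B * x + C

  -- Divided differences: two roots give A (x + y) + B = 0, and two such relations sharing x differ
  -- by (y - z) A.
  three-roots : ∀ {A B C x y z} → x ≢ y → x ≢ z → y ≢ z →
    quadratic A B C x ≡ 0# → quadratic A B C y ≡ 0# → quadratic A B C z ≡ 0# →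
    A ≡ 0# × B ≡ 0# × C ≡ 0#
  three-roots {A} {B} {C} {x} {y} {z} x≢y x≢z y≢z x-root y-root z-root = A≡0 , B≡0 , C≡0
    where
    slope : ∀ {x y} → x ≢ y → quadratic A B C x ≡ 0# → quadratic A B C y ≡ 0# → A * (x + y) + B ≡ 0#
    slope {x} {y} x≢y x-root y-root = x*y≡0⇒y≡0 (x-y≢0 x≢y) (begin
      (x - y) * (A * (x + y) + B)
        ≡⟨ solve 5 (λ A B C x y → (x :- y) :* (A :* (x :+ y) :+ B)
             := (A :* (x :* x) :+ B :* x :+ C) :- (A :* (y :* y) :+ B :* y :+ C)) refl A B C x y ⟩
      quadratic A B C x - quadratic A B C y   ≡⟨ cong₂ _-_ x-root y-root ⟩
      0# - 0#                                 ≡⟨ -‿inverseʳ 0# ⟩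
      0#                                      ∎)
    A≡0 : A ≡ 0#
    A≡0 = x*y≡0⇒y≡0 (x-y≢0 y≢z) (begin
      (y - z) * A
        ≡⟨ solve 5 (λ A B x y z → (y :- z) :* A := (A :* (x :+ y) :+ B) :- (A :* (x :+ z) :+ B)) refl A B x y z ⟩
      (A * (x + y) + B) - (A * (x + z) + B)
        ≡⟨ cong₂ _-_ (slope x≢y x-root y-root) (slope x≢z x-root z-root) ⟩
      0# - 0#   ≡⟨ -‿inverseʳ 0# ⟩
      0#        ∎)
    B≡0 : B ≡ 0#
    B≡0 = trans (sym (trans (cong (_+ B) (x≡0⇒x*y≡0 A≡0)) (+-identityˡ B))) (slope x≢y x-root y-root)
    C≡0 : C ≡ 0#
    C≡0 = trans (sym (trans (cong (_+ C) (trans (cong₂ _+_ (x≡0⇒x*y≡0 A≡0) (x≡0⇒x*y≡0 B≡0)) (+-identityˡ 0#))) (+-identityˡ C))) x-root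

  module _ (T : Transformation) (g : Carrier → Carrier) (s w : Carrier) where
    open Transformation T

    private
      -- With N / D and N′ / D′ the values of the fraction at y and s y, these are the coefficients
      -- in y of N D′ - N′ D + w D D′, the cleared form of g (s y) = w + g y. The determinant enters
      -- through N D′ - N′ D = (1 - s) (α δ - β γ) y.
      A B C : Carrier
      A = w * (γ * γ * s)
      B = (1# - s) * (α * δ - β * γ) + w * (γ * δ * (1# + s))
      C = w * (δ * δ)

      root : ∀ {y} → Agrees T g y → Agrees T g (s * y) → g (s * y) ≡ w + g y → quadratic A B C y ≡ 0#
      root {y} at-y at-sy shift = begin
        quadratic A B C y
          ≡⟨ solve 6 (λ A E G C w y → A :* (y :* y) :+ (E :+ w :* G) :* y :+ C
               := E :* y :+ (A :* (y :* y) :+ w :* (G :* y) :+ C)) refl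
               A ((1# - s) * (α * δ - β * γ)) (γ * δ * (1# + s)) C w y ⟩
        (1# - s) * (α * δ - β * γ) * y + (A * (y * y) + w * (γ * δ * (1# + s) * y) + C)
          ≡⟨ cong₂ _+_ determinant-part product-part ⟩
        (N * D′ - N′ * D) + w * (D * D′)
          ≡⟨ cong₂ (λ u v → (u * D′ - v * D) + w * (D * D′)) (sym at-y) (trans (sym at-sy) (cong (_* D′) shift)) ⟩
        (g y * D * D′ - (w + g y) * D′ * D) + w * (D * D′)
          ≡⟨ solve 4 (λ w v D D′ → (v :* D :* D′ :- (w :+ v) :* D′ :* D) :+ w :* (D :* D′) := con (0 , 0))
               refl w (g y) D D′ ⟩
        0# ∎
        where
        N D N′ D′ : Carrier
        N  = α * y + β
        D  = γ * y + δ
        N′ = α * (s * y) + β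
        D′ = γ * (s * y) + δ
        scale : ∀ u v → u * (s * y) + v ≡ s * (u * y + v) + (1# - s) * v
        scale u v = solve 4 (λ u v s y → u :* (s :* y) :+ v := s :* (u :* y :+ v) :+ (con (1 , 0) :- s) :* v) refl u v s y
        determinant-part : (1# - s) * (α * δ - β * γ) * y ≡ N * D′ - N′ * D
        determinant-part = begin
          (1# - s) * (α * δ - β * γ) * y
            ≡⟨ trans (*-assoc _ _ y) (cong ((1# - s) *_)
                 (solve 5 (λ α β γ δ y → (α :* δ :- β :* γ) :* y := (α :* y :+ β) :* δ :- β :* (γ :* y :+ δ))
                   refl α β γ δ y)) ⟩
          (1# - s) * (N * δ - β * D)
            ≡⟨ solve 5 (λ N D s β δ → (con (1 , 0) :- s) :* (N :* δ :- β :* D)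
                 := N :* (s :* D :+ (con (1 , 0) :- s) :* δ) :- (s :* N :+ (con (1 , 0) :- s) :* β) :* D)
                 refl N D s β δ ⟩
          N * (s * D + (1# - s) * δ) - (s * N + (1# - s) * β) * D
            ≡⟨ cong₂ (λ u v → N * u - v * D) (scale γ δ) (scale α β) ⟨
          N * D′ - N′ * D ∎
        product-part : A * (y * y) + w * (γ * δ * (1# + s) * y) + C ≡ w * (D * D′)
        product-part = solve 5 (λ γ δ s w y →
          w :* (γ :* γ :* s) :* (y :* y) :+ w :* (γ :* δ :* (con (1 , 0) :+ s) :* y) :+ w :* (δ :* δ)
          := w :* ((γ :* y :+ δ) :* (γ :* (s :* y) :+ δ))) refl γ δ s w y

    -- If w = 0, then B is (1 - s) times the determinant. If w ≠ 0, then A and C force γ = δ = 0,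
    -- and the determinant vanishes.
    coefficients≢0 : s ≢ 0# → s ≢ 1# → A ≡ 0# → B ≡ 0# → C ≡ 0# → ⊥
    coefficients≢0 s≢0 s≢1 A≡0 B≡0 C≡0 = by-cases (w ≟ 0#)
      where
      square≡0 : ∀ {x} → x * x ≡ 0# → x ≡ 0#
      square≡0 {x} eq with x ≟ 0#
      ... | yes x≡0 = x≡0
      ... | no  x≢0 = x*y≡0⇒y≡0 x≢0 eq
      by-cases : Dec (w ≡ 0#) → ⊥
      by-cases (yes w≡0) = x*y≢0 (x-y≢0 (s≢1 ∘ sym)) (x-y≢0 nondegenerate) (begin
        (1# - s) * (α * δ - β * γ)          ≡⟨ +-identityʳ _ ⟨
        (1# - s) * (α * δ - β * γ) + 0#     ≡⟨ cong ((1# - s) * (α * δ - β * γ) +_) (x≡0⇒x*y≡0 w≡0) ⟨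
        B                                   ≡⟨ B≡0 ⟩
        0#                                  ∎)
      by-cases (no w≢0) = nondegenerate (trans (y≡0⇒x*y≡0 δ≡0) (sym (y≡0⇒x*y≡0 γ≡0)))
        where
        γ≡0 : γ ≡ 0#
        γ≡0 = square≡0 (x*y≡0⇒y≡0 s≢0 (trans (*-comm s (γ * γ)) (x*y≡0⇒y≡0 w≢0 A≡0)))
        δ≡0 : δ ≡ 0#
        δ≡0 = square≡0 (x*y≡0⇒y≡0 w≢0 C≡0)

    no-three-shifts : s ≢ 0# → s ≢ 1# → ∀ {x y z} → x ≢ y → x ≢ z → y ≢ z →
      (∀ {v} → v ≡ x ⊎ v ≡ y ⊎ v ≡ z → Agrees T g v × Agrees T g (s * v) × g (s * v) ≡ w + g v) → ⊥
    no-three-shifts s≢0 s≢1 x≢y x≢z y≢z shifts =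
      let A≡0 , B≡0 , C≡0 = three-roots x≢y x≢z y≢z
            (root′ (inj₁ refl)) (root′ (inj₂ (inj₁ refl))) (root′ (inj₂ (inj₂ refl)))
      in coefficients≢0 s≢0 s≢1 A≡0 B≡0 C≡0
      where
      root′ : ∀ {v} → _ → quadratic A B C v ≡ 0#
      root′ {v} v∈ = let at-v , at-sv , shift = shifts {v} v∈ in root at-v at-sv shift

-- Carlitz rank: counting pairs of agreement points by their digit differences.

module CarlitzRank {c : Level} {q : ℕ} (F : FiniteField c q) (p : ℕ) (p-prime : Prime p) (n : ℕ) (q≡p^n : q ≡ p ℕ.^ n)
  (ζ θ : FiniteField.Carrier F) (ζ-primitive : IsPrimitive F ζ) (θ-generates : ∀ x → x ∈ Adjoin p F θ)
  (f : FiniteField.Carrier F → FiniteField.Carrier F) (isDigitMap : IsDigitMap p F n ζ θ f) where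

  open DigitMap F p p-prime n q≡p^n ζ θ ζ-primitive θ-generates f isDigitMap
  open Möbius F
  open ≡-Reasoning

  module ℕ-Sum = Sum ℕ.+-*-semiring

  -- x_i - y_i, moved into the range 0, …, 2p - 1.
  digitDifference : Carrier × Carrier → Fin n → Fin (2 ℕ.* p)
  digitDifference (x , y) i = fromℕ< {toℕ (digitsOf x i) ℕ.+ (p ∸ toℕ (digitsOf y i))}
    (subst (toℕ (digitsOf x i) ℕ.+ (p ∸ toℕ (digitsOf y i)) <_) (cong (p ℕ.+_) (sym (ℕ.+-identityʳ p)))
      (ℕ.+-mono-<-≤ (Fin.toℕ<n (digitsOf x i)) (ℕ.m∸n≤m p (toℕ (digitsOf y i)))))

  module _ {x y x′ y′ : Carrier} (eq : ∀ i → digitDifference (x , y) i ≡ digitDifference (x′ , y′) i) where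

    -- Equal differences are restated as equal sums, avoiding truncated subtraction; `number` and
    -- `vector` are additive in the digits, so the relation passes to exponents and to values of f.
    digits-exchange : ∀ i → toℕ (digitsOf x i) ℕ.+ toℕ (digitsOf y′ i) ≡ toℕ (digitsOf x′ i) ℕ.+ toℕ (digitsOf y i)
    digits-exchange i = ℕ.+-cancelʳ-≡ p _ _ (begin
      (X ℕ.+ Y′) ℕ.+ p                   ≡⟨ cong ((X ℕ.+ Y′) ℕ.+_) (p≡ y) ⟩
      (X ℕ.+ Y′) ℕ.+ ((p ∸ Y) ℕ.+ Y)     ≡⟨ regroup X Y′ (p ∸ Y) Y ⟩
      (X ℕ.+ (p ∸ Y)) ℕ.+ (Y ℕ.+ Y′)     ≡⟨ cong (ℕ._+ (Y ℕ.+ Y′)) same ⟩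
      (X′ ℕ.+ (p ∸ Y′)) ℕ.+ (Y ℕ.+ Y′)   ≡⟨ regroup′ X′ (p ∸ Y′) Y Y′ ⟩
      (X′ ℕ.+ Y) ℕ.+ ((p ∸ Y′) ℕ.+ Y′)   ≡⟨ cong ((X′ ℕ.+ Y) ℕ.+_) (p≡ y′) ⟨
      (X′ ℕ.+ Y) ℕ.+ p                   ∎)
      where
      X Y X′ Y′ : ℕ
      X = toℕ (digitsOf x i)
      Y = toℕ (digitsOf y i)
      X′ = toℕ (digitsOf x′ i)
      Y′ = toℕ (digitsOf y′ i)
      p≡ : ∀ y → p ≡ (p ∸ toℕ (digitsOf y i)) ℕ.+ toℕ (digitsOf y i)
      p≡ y = sym (ℕ.m∸n+n≡m (ℕ.<⇒≤ (Fin.toℕ<n (digitsOf y i))))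
      same : X ℕ.+ (p ∸ Y) ≡ X′ ℕ.+ (p ∸ Y′)
      same = trans (sym (Fin.toℕ-fromℕ< _)) (trans (cong toℕ (eq i)) (Fin.toℕ-fromℕ< _))
      regroup : ∀ a b c d → (a ℕ.+ b) ℕ.+ (c ℕ.+ d) ≡ (a ℕ.+ c) ℕ.+ (d ℕ.+ b)
      regroup = ℕ-Solver.solve-∀
      regroup′ : ∀ a b c d → (a ℕ.+ b) ℕ.+ (c ℕ.+ d) ≡ (a ℕ.+ c) ℕ.+ (b ℕ.+ d)
      regroup′ = ℕ-Solver.solve-∀

    number-exchange : number (digitsOf x) ℕ.+ number (digitsOf y′) ≡ number (digitsOf x′) ℕ.+ number (digitsOf y)
    number-exchange = begin
      number (digitsOf x) ℕ.+ number (digitsOf y′)   ≡⟨ merge x y′ ⟨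
      Σℕ (λ i → (toℕ (digitsOf x i) ℕ.+ toℕ (digitsOf y′ i)) ℕ.* p ℕ.^ toℕ i)
        ≡⟨ ℕ-Sum.sum-cong-≗ {n} (λ i → cong (ℕ._* p ℕ.^ toℕ i) (digits-exchange i)) ⟩
      Σℕ (λ i → (toℕ (digitsOf x′ i) ℕ.+ toℕ (digitsOf y i)) ℕ.* p ℕ.^ toℕ i)
        ≡⟨ merge x′ y ⟩
      number (digitsOf x′) ℕ.+ number (digitsOf y)   ∎
      where
      merge : ∀ u v → Σℕ (λ i → (toℕ (digitsOf u i) ℕ.+ toℕ (digitsOf v i)) ℕ.* p ℕ.^ toℕ i)
        ≡ number (digitsOf u) ℕ.+ number (digitsOf v)
      merge u v = trans (ℕ-Sum.sum-cong-≗ {n} (λ i → ℕ.*-distribʳ-+ (p ℕ.^ toℕ i) (toℕ (digitsOf u i)) _))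
        (ℕ-Sum.∑-distrib-+ {n} (λ i → toℕ (digitsOf u i) ℕ.* p ℕ.^ toℕ i) _)

    f-exchange : f x + f y′ ≡ f x′ + f y
    f-exchange = begin
      f x + f y′   ≡⟨ merge x y′ ⟨
      sum (λ i → (toℕ (digitsOf x i) ℕ.+ toℕ (digitsOf y′ i)) ×ᶠ (θ ^ toℕ i))
        ≡⟨ sum-cong-≗ {n} (λ i → cong (_×ᶠ (θ ^ toℕ i)) (digits-exchange i)) ⟩
      sum (λ i → (toℕ (digitsOf x′ i) ℕ.+ toℕ (digitsOf y i)) ×ᶠ (θ ^ toℕ i))
        ≡⟨ merge x′ y ⟩
      f x′ + f y   ∎
      where
      merge : ∀ u v → sum (λ i → (toℕ (digitsOf u i) ℕ.+ toℕ (digitsOf v i)) ×ᶠ (θ ^ toℕ i)) ≡ f u + f v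
      merge u v = trans (sum-cong-≗ {n} (λ i → ×-homo-+ (θ ^ toℕ i) (toℕ (digitsOf u i)) _))
        (trans (∑-distrib-+ {n} (λ i → toℕ (digitsOf u i) ×ᶠ (θ ^ toℕ i)) _)
          (cong₂ _+_ (vector-digitsOf u) (vector-digitsOf v)))

    -- Exponents represent nonzero points only: the number attached to 0 is q - 1, and ζ^(q-1) = 1.
    -- This is why 0 is removed from the agreement points.
    *-exchange : x ≢ 0# → y ≢ 0# → x′ ≢ 0# → y′ ≢ 0# → x * y′ ≡ x′ * y
    *-exchange x≢0 y≢0 x′≢0 y′≢0 = begin
      x * y′                                                     ≡⟨ cong₂ _*_ (ζ^digitsOf x≢0) (ζ^digitsOf y′≢0) ⟨
      ζ ^ number (digitsOf x) * ζ ^ number (digitsOf y′)         ≡⟨ ^-homo-* ζ (number (digitsOf x)) _ ⟨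
      ζ ^ (number (digitsOf x) ℕ.+ number (digitsOf y′))         ≡⟨ cong (ζ ^_) number-exchange ⟩
      ζ ^ (number (digitsOf x′) ℕ.+ number (digitsOf y))         ≡⟨ ^-homo-* ζ (number (digitsOf x′)) _ ⟩
      ζ ^ number (digitsOf x′) * ζ ^ number (digitsOf y)         ≡⟨ cong₂ _*_ (ζ^digitsOf x′≢0) (ζ^digitsOf y≢0) ⟩
      x′ * y                                                     ∎

  module _ (T : Transformation) {xs : List Carrier} (xs-unique : Unique xs)
    (nonzero : ∀ {x} → x ∈ˡ xs → x ≢ 0#) (agrees : ∀ {x} → x ∈ˡ xs → Agrees T f x) where

    pairs : List (Carrier × Carrier)
    pairs = cartesianProduct xs xs

    pairs-unique : Unique pairs
    pairs-unique = Unique.cartesianProduct⁺ xs-unique xs-unique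

    diagonal? : Decidable (λ ((x , y) : Carrier × Carrier) → x ≡ y)
    diagonal? (x , y) = x ≟ y

    difference : Carrier × Carrier → ℕ
    difference xy = toℕ (funToFin (digitDifference xy))

    offDiagonal : List (Carrier × Carrier)
    offDiagonal = filter (¬? ∘ diagonal?) pairs

    -- On the diagonal s = 1 and w = 0, so the quadratic is identically zero and says nothing; these
    -- pairs are counted separately.
    diagonal≤ : length (filter diagonal? pairs) ≤ q
    diagonal≤ = unique-length≤ (Unique.filter⁺ diagonal? pairs-unique) (index ∘ proj₁) λ { {x , y} {x′ , y′} xy∈ xy′∈ eq →
      let x≡y  = proj₂ (∈-filter⁻ diagonal? {xs = pairs} xy∈)
          x′≡y′ = proj₂ (∈-filter⁻ diagonal? {xs = pairs} xy′∈)
          x≡x′ = index-injective eq in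
      cong₂ _,_ x≡x′ (trans (sym x≡y) (trans x≡x′ x′≡y′)) }

    fibre≤2 : ∀ j → length (filter (λ xy → difference xy ℕ.≟ j) offDiagonal) ≤ 2
    fibre≤2 j = unique-length≤2 (Unique.filter⁺ _ (Unique.filter⁺ (¬? ∘ diagonal?) pairs-unique)) no-three
      where
      fibre : List (Carrier × Carrier)
      fibre = filter (λ xy → difference xy ℕ.≟ j) offDiagonal

      module _ {x y} (xy∈ : (x , y) ∈ˡ fibre) where
        private
          split = ∈-filter⁻ (λ xy → difference xy ℕ.≟ j) {xs = offDiagonal} xy∈
          split′ = ∈-filter⁻ (¬? ∘ diagonal?) {xs = pairs} (proj₁ split)
          split″ = ∈-cartesianProduct⁻ xs xs (proj₁ split′)
        fst∈ : x ∈ˡ xs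
        fst∈ = proj₁ split″
        snd∈ : y ∈ˡ xs
        snd∈ = proj₂ split″
        fst≢snd : x ≢ y
        fst≢snd = proj₂ split′
        difference≡j : difference (x , y) ≡ j
        difference≡j = proj₂ split

      same-difference : ∀ {xy xy′} → xy ∈ˡ fibre → xy′ ∈ˡ fibre → ∀ i → digitDifference xy i ≡ digitDifference xy′ i
      same-difference xy∈ xy′∈ = funToFin-injective
        (Fin.toℕ-injective (trans (difference≡j xy∈) (sym (difference≡j xy′∈))))

      ratio : ∀ {x y x′ y′} → (x , y) ∈ˡ fibre → (x′ , y′) ∈ˡ fibre → x * y′ ≡ x′ * y
      ratio xy∈ xy′∈ = *-exchange (same-difference xy∈ xy′∈) (nonzero (fst∈ xy∈)) (nonzero (snd∈ xy∈))
        (nonzero (fst∈ xy′∈)) (nonzero (snd∈ xy′∈))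

      -- The ratio is constant on a fibre, so the second component determines the pair; three pairs
      -- therefore yield three distinct roots.
      snd-injective : ∀ {xy xy′} → xy ∈ˡ fibre → xy′ ∈ˡ fibre → xy ≢ xy′ → proj₂ xy ≢ proj₂ xy′
      snd-injective {x , y} {x′ , .y} xy∈ xy′∈ xy≢xy′ refl = xy≢xy′ (cong (_, y)
        (*-cancelˡ (nonzero (snd∈ xy∈)) (trans (*-comm y x) (trans (ratio xy∈ xy′∈) (*-comm x′ y)))))

      no-three : ∀ {u v w} → u ∈ˡ fibre → v ∈ˡ fibre → w ∈ˡ fibre → u ≢ v → u ≢ w → v ≢ w → ⊥
      no-three {x , y} {v} {w} u∈ v∈ w∈ u≢v u≢w v≢w =
        no-three-shifts T f s (f x - f y)
          (x*y≢0 (nonzero (fst∈ u∈)) (⁻¹≢0 y≢0)) s≢1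
          (snd-injective u∈ v∈ u≢v) (snd-injective u∈ w∈ u≢w) (snd-injective v∈ w∈ v≢w)
          λ { (inj₁ refl) → shift u∈ ; (inj₂ (inj₁ refl)) → shift v∈ ; (inj₂ (inj₂ refl)) → shift w∈ }
        where
        y≢0 : y ≢ 0#
        y≢0 = nonzero (snd∈ u∈)
        -- The ratio and the shift f x - f y are read off the first pair; the exchange laws make
        -- them common to the whole fibre.
        s : Carrier
        s = x * y ⁻¹
        s*y′≡x′ : ∀ {x′ y′} → (x′ , y′) ∈ˡ fibre → s * y′ ≡ x′
        s*y′≡x′ {x′} {y′} ∈fibre = begin
          x * y ⁻¹ * y′     ≡⟨ solve 3 (λ x i y → x :* i :* y := x :* y :* i) refl x (y ⁻¹) y′ ⟩
          x * y′ * y ⁻¹     ≡⟨ cong (_* y ⁻¹) (ratio u∈ ∈fibre) ⟩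
          x′ * y * y ⁻¹     ≡⟨ *-assoc x′ y (y ⁻¹) ⟩
          x′ * (y * y ⁻¹)   ≡⟨ cong (x′ *_) (*-inverseʳ y y≢0) ⟩
          x′ * 1#           ≡⟨ *-identityʳ x′ ⟩
          x′                ∎
        s≢1 : s ≢ 1#
        s≢1 s≡1 = fst≢snd u∈ (trans (sym (s*y′≡x′ u∈)) (trans (cong (_* y) s≡1) (*-identityˡ y)))
        shift : ∀ {x′ y′} → (x′ , y′) ∈ˡ fibre →
          Agrees T f y′ × Agrees T f (s * y′) × f (s * y′) ≡ (f x - f y) + f y′
        shift {x′} {y′} ∈fibre =
          agrees (snd∈ ∈fibre) , subst (Agrees T f) (sym (s*y′≡x′ ∈fibre)) (agrees (fst∈ ∈fibre)) , (begin
            f (s * y′)             ≡⟨ cong f (s*y′≡x′ ∈fibre) ⟩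
            f x′                   ≡⟨ solve 2 (λ u v → u := (u :+ v) :- v) refl (f x′) (f y) ⟩
            (f x′ + f y) - f y     ≡⟨ cong (_- f y) (f-exchange (same-difference u∈ ∈fibre)) ⟨
            (f x + f y′) - f y     ≡⟨ solve 3 (λ u v w → (u :+ v) :- w := (u :- w) :+ v) refl (f x) (f y′) (f y) ⟩
            (f x - f y) + f y′     ∎)

    agreement≤ : length xs ℕ.* length xs ≤ q ℕ.+ (2 ℕ.* p) ℕ.^ n ℕ.* 2
    agreement≤ = subst (_≤ q ℕ.+ (2 ℕ.* p) ℕ.^ n ℕ.* 2)
      (trans (sym (length-filter-split diagonal? pairs)) (length-cartesianProduct xs xs))
      (ℕ.+-mono-≤ diagonal≤ (length≤-by-fibres ((2 ℕ.* p) ℕ.^ n) 2 difference offDiagonal (λ _ → Fin.toℕ<n _) fibre≤2))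

  private
    square : ∀ x → (1 ℕ.+ x) ℕ.* ((1 ℕ.+ x) ℕ.* 1) ≡ x ℕ.* x ℕ.+ 2 ℕ.* x ℕ.+ 1
    square = ℕ-Solver.solve-∀

    total : ∀ x → (x ℕ.+ x ℕ.* 2) ℕ.+ 2 ℕ.* x ℕ.+ x ℕ.+ 3 ℕ.* x ≡ 9 ℕ.* x
    total = ℕ-Solver.solve-∀

  -- With b agreement points and Q = (2p)^n, b² ≤ q + 2 Q ≤ 3 Q. Hence (1 + b)² ≤ 3 Q + 2 Q + Q = 6
  -- Q, which the square of the constant 3 covers with 3 Q to spare.
  carlitz-rank≥ : ∀ r → IsCarlitzRank F f r → (p ℕ.^ n ∸ r) ℕ.^ 2 ≤ 3 ℕ.^ 2 ℕ.* (2 ℕ.* p) ℕ.^ n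
  carlitz-rank≥ r ((gs , refl , compose≗f) , _) =
    ℕ.≤-trans (ℕ.^-monoˡ-≤ 2 q∸r≤1+b) (ℕ.≤-trans (ℕ.≤-reflexive (square b))
      (ℕ.≤-trans (ℕ.+-mono-≤ (ℕ.+-mono-≤ b²≤ (ℕ.*-monoʳ-≤ 2 b≤Q)) 1≤Q)
        (ℕ.≤-trans (ℕ.m≤m+n _ (3 ℕ.* Q)) (ℕ.≤-reflexive (total Q)))))
    where
    open DecMembership _≟_ using (_∈?_)
    T = proj₁ (transform gs)
    poles = proj₁ (proj₂ (transform gs))
    poles≤r = proj₁ (proj₂ (proj₂ (transform gs)))
    -- Discarding 0 besides the at most r poles accounts for the 1 in q - r ≤ 1 + b.
    avoids? : Decidable (_∉ (0# ∷ poles))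
    avoids? x = ¬? (x ∈? (0# ∷ poles))
    good : List Carrier
    good = filter avoids? elements
    avoids : ∀ {x} → x ∈ˡ good → x ∉ (0# ∷ poles)
    avoids x∈ = proj₂ (∈-filter⁻ avoids? {xs = elements} x∈)
    good-agrees : ∀ {x} → x ∈ˡ good → Agrees T f x
    good-agrees {x} x∈ = subst (λ v → v * (_ * x + _) ≡ _ * x + _) (compose≗f x)
      (proj₂ (proj₂ (proj₂ (transform gs))) x (avoids x∈ ∘ there))
    b Q : ℕ
    b = length good
    Q = (2 ℕ.* p) ℕ.^ n
    q≤Q : q ≤ Q
    q≤Q = ℕ.≤-trans (ℕ.≤-reflexive q≡p^n) (ℕ.^-monoˡ-≤ n (ℕ.m≤m+n p _))
    b≤Q : b ≤ Q
    b≤Q = ℕ.≤-trans (length-filter avoids? elements) (ℕ.≤-trans (ℕ.≤-reflexive length-elements) q≤Q)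
    1≤Q : 1 ≤ Q
    1≤Q = ℕ.≤-trans (ℕ.≤-trans 1≤q∸1 (ℕ.m∸n≤m q 1)) q≤Q
    b²≤ : b ℕ.* b ≤ Q ℕ.+ Q ℕ.* 2
    b²≤ = ℕ.≤-trans (agreement≤ T (Unique.filter⁺ avoids? elements-unique)
      (λ x∈ → avoids x∈ ∘ here) good-agrees) (ℕ.+-monoˡ-≤ (Q ℕ.* 2) q≤Q)
    q∸r≤1+b : p ℕ.^ n ∸ inversions F gs ≤ suc b
    q∸r≤1+b = ℕ.m≤n+o⇒m∸n≤o (p ℕ.^ n) (inversions F gs) (subst₂ _≤_ (trans length-elements q≡p^n) refl
      (ℕ.≤-trans (length≤-∉ _≟_ elements-unique (0# ∷ poles))
        (ℕ.≤-trans (ℕ.+-monoˡ-≤ b (s≤s poles≤r)) (ℕ.≤-reflexive (sym (ℕ.+-suc _ b))))))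

-- Assembly of the four bounds.

open import Data.Nat using (_+_; _*_; _^_; _/_)

theorem5 : {c : Level} (p n : ℕ) (p-prime : Prime p) → 1 ≤ n →
    let q = p ^ n
        q/p = _/_ q p {{prime⇒nonZero p-prime}} in
    (F : FiniteField c q) → let open FiniteField F using (Carrier) in
    (ζ θ : Carrier) → IsPrimitive F ζ → (∀ x → x ∈ Adjoin p F θ) →
    (f : Carrier → Carrier) → IsDigitMap p F n ζ θ f →
    Bijective _≡_ _≡_ f ×
    (∀ P → Represents F P f → q ∸ q/p ∸ 1 ≤ degree F P × q ∸ q/p ≤ weight F P) ×
    -- AddInd(f) ≥ pⁿ / (n + 2), with the denominator cleared
    (∀ m → IsAdditiveIndex p F n f m → p ^ n ≤ (n + 2) * m) ×
    -- pⁿ - Crk(f) ≤ 3 (2p)^(n/2), squared; _∸_ makes it vacuous for Crk(f) ≥ pⁿ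
    (2 < p → ∀ r → IsCarlitzRank F f r → (p ^ n ∸ r) ^ 2 ≤ 3 ^ 2 * (2 * p) ^ n)
theorem5 p n@(suc m) p-prime _ F ζ θ ζ-primitive θ-generates f isDigitMap =
  DigitMap.f-bijective F p p-prime n refl ζ θ ζ-primitive θ-generates f isDigitMap ,
  (λ P represents →
    let weight≥ = subst (λ k → p ^ n ∸ k ≤ weight F P) (sym q/p≡p^m)
          (DigitMapPolynomial.weight≥ F p p-prime m refl ζ θ ζ-primitive θ-generates f isDigitMap P represents)
    in ℕ.∸-monoˡ-≤ 1 (ℕ.≤-trans weight≥ (Polynomials.weight≤1+degree F P)) , weight≥) ,
  AdditiveIndex.additive-index≥ F p p-prime n refl ζ θ ζ-primitive θ-generates f isDigitMap ,
  λ _ → CarlitzRank.carlitz-rank≥ F p p-prime n refl ζ θ ζ-primitive θ-generates f isDigitMap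
  where
  instance
    p-nonZero : NonZero p
    p-nonZero = prime⇒nonZero p-prime
  q/p≡p^m : p ^ suc m / p ≡ p ^ m
  q/p≡p^m = trans (ℕ./-congˡ {o = p} (ℕ.*-comm p (p ^ m))) (ℕ.m*n/n≡m (p ^ m) p)
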